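{- Let $\Pi_1$ and $\Pi_2$ be logic programs (in the input language with arithmetic, intervals, tuples, pools, negation and simple choice rules described in the context). Then $\Pi_1$ is strongly equivalent to $\Pi_2$ if and only if $\sigma^*(\tau^*\Pi_1)$ is equivalent to $\sigma^*(\tau^*\Pi_2)$ in every standard classical interpretation $I$ over the alphabet $\mathcal{P} \cup \mathcal{P}'$ such that $I \models \mathcal{A}$; that is, for every such $I$, $I$ satisfies all formulas in $\sigma^*(\tau^*\Pi_1)$ if and only if $I$ satisfies all formulas in $\sigma^*(\tau^*\Pi_2)$.
   Context: **Input language.** There are numerals $\overline{n}$ (one for each integer $n$, identified with $n$), infinitely many symbolic constants, the two special symbols $\mathit{inf}$ and $\mathit{sup}$, and program variables. *Program terms*: numerals, symbolic constants, program variables, $\mathit{inf}$, $\mathit{sup}$ are program terms; if $t_1,t_2$ are program terms, so are $(t_1 \circ t_2)$ for $\circ \in \{+,-,\times,/,\backslash\}$ and the interval $(t_1\,..\,t_2)$; if $t_1,\dots,t_k$ are program terms, so are the tuple $(t_1,\dots,t_k)$ and the pool $(t_1;\dots;t_k)$. An *atom* is $p(\mathbf{t})$ or, with a pool, $p(\mathbf{t_1};\dots;\mathbf{t_k})$, where $p$ is a symbolic constant and $\mathbf{t},\mathbf{t_1},\dots,\mathbf{t_k}$ are (possibly empty) tuples of program terms. A *literal* is $A$, $\mathit{not}\,A$ or $\mathit{not}\,\mathit{not}\,A$ for an atom $A$. A *comparison* is $t_1 \sim t_2$ with $\sim\, \in \{=,\neq,<,>,\le,\ge\}$. A *rule* is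 $H \leftarrow B_1 \land \dots \land B_n$ ($n \ge 0$), where each $B_i$ is a literal or comparison and the head $H$ is an atom $A$ (basic rule), $\{A\}$ for an atom $A$ (choice rule), or empty (constraint). A *program* is a finite set of rules. **Precomputed terms and values.** Precomputed terms are numerals, symbolic constants, $\mathit{inf}$, $\mathit{sup}$ and, recursively, tuples of precomputed terms. A total order on precomputed terms is fixed, with least element $\mathit{inf}$, greatest element $\mathit{sup}$, and ordering numerals as the corresponding integers; comparison symbols refer to this order. For a variable-free program term $t$, its set of values $[t]$ is: $[t]=\{t\}$ if $t$ is a numeral, symbolic constant, $\mathit{inf}$ or $\mathit{sup}$; $[t_1 \circ t_2]$ for $\circ\in\{+,-,\times\}$ is the set of numerals $n_1 \circ n_2$ for numerals $n_1\in[t_1]$, $n_2\in[t_2]$; $[t_1/t_2]$ (resp. $[t_1\backslash t_2]$) is the set of numerals $\lfloor n_1/n_2\rfloor$ (resp. $n_1-n_2\lfloor n_1/n_2\rfloor$) for numerals $n_1\in[t_1]$, $n_2\in[t_2]$, $n_2\neq 0$; $[t_1\,..\,t_2]$ is the set of numerals $m$ with $n_1\le m\le n_2$ for some numerals $n_1\in[t_1]$, $n_2\in[t_2]$; $[(t_1,\dots,t_k)]=\{(r_1,\dots,r_k) \mid r_i\in[t_i]\}$; $[(t_1;\dots;t_k)]=[t_1]\cup\dots\cup[t_k]$. For a tuple $\mathbf{t}=t_1,\dots,t_k$ used as arguments of an atom, $[\mathbf{t}]=[t_1]\times\dots\times[t_k]$. **Semantics of programs (usual stable model semantics).** $\mathcal{P}$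 is the set of precomputed atoms $p(\mathbf{r})$ with $p$ a symbolic constant and $\mathbf{r}$ a tuple of precomputed terms (atoms with different arities are different). An instance of a rule is obtained by substituting precomputed terms for all its variables. To an instance one assigns an infinitary propositional formula over $\mathcal{P}$, the implication from the conjunction of its translated body expressions to its translated head. In the body, $p(\mathbf{t_1};\dots;\mathbf{t_k})$ becomes $\bigvee_i\bigvee_{\mathbf{r}\in[\mathbf{t_i}]}p(\mathbf{r})$, and $\mathit{not}\,p(\mathbf{t_1};\dots;\mathbf{t_k})$ and $\mathit{not}\,\mathit{not}\,p(\mathbf{t_1};\dots;\mathbf{t_k})$ become the same disjunction with $\neg p(\mathbf{r})$, resp. $\neg\neg p(\mathbf{r})$, in place of $p(\mathbf{r})$; $t_1\sim t_2$ becomes $\top$ if $r_1\sim r_2$ for some $r_1\in[t_1],r_2\in[t_2]$, and $\bot$ otherwise. In the head, $p(\mathbf{t_1};\dots;\mathbf{t_k})$ becomes $\bigwedge_i\bigwedge_{\mathbf{r}\in[\mathbf{t_i}]}p(\mathbf{r})$; $\{p(\mathbf{t_1};\dots;\mathbf{t_k})\}$ becomes $\bigwedge_i\bigwedge_{\mathbf{r}\in[\mathbf{t_i}]}(p(\mathbf{r})\lor\neg p(\mathbf{r}))$; the empty head becomes $\bot$. (Atoms $p(\mathbf{t})$ without a pool are the case $k=1$.) $\tau\Pi$ is the set of formulas so obtained from all instances of all rules of $\Pi$. The answer sets of $\Pi$ are the stable models of $\tau\Pi$: sets $X\subseteq\mathcal{P}$ such that $\langle X,X\rangle$ satisfies $\tau\Pi$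 and no $\langle Y,X\rangle$ with $Y\subsetneq X$ satisfies $\tau\Pi$, where satisfaction by pairs $\langle H,T\rangle$ with $H\subseteq T$ is here-and-there satisfaction: $\langle H,T\rangle\models p$ iff $p\in H$; $\bigwedge,\bigvee$ (including $\top$, $\bot$) as usual; $\langle H,T\rangle\models\neg F$ iff $\langle T,T\rangle\not\models F$; $\langle H,T\rangle\models F\rightarrow G$ iff both ($\langle H,T\rangle\models F$ implies $\langle H,T\rangle\models G$) and ($\langle T,T\rangle\models F$ implies $\langle T,T\rangle\models G$). Programs $\Pi_1,\Pi_2$ are *strongly equivalent* if for every program $\Pi$, $\Pi_1\cup\Pi$ and $\Pi_2\cup\Pi$ have the same answer sets. **Target first-order language.** It has two sorts of variables: program variables (ranging over precomputed terms) and integer variables (ranging over numerals). Terms are built from precomputed constants, variables, the operations $+,-,\times$ on integer terms, and tupling. Atomic formulas are $p(Z_1,\dots,Z_k)$ and comparisons; connectives are $\bot,\top,\neg,\land,\lor,\rightarrow$ and quantifiers $\forall,\exists$. **The formula $\mathit{val}_t(Z)$** ($t$ a program term, $Z$ a program variable not occurring in $t$; $\mathit{val}_t(I)$ for an integer variable $I$ is given by the same clauses with $I$ in place of $Z$; below, $I,J,K,Q,R$ are fresh integer variables and $I_1,\dots,I_k$ fresh program variables): - $t$ a numeral, symbolic constant, program variable, $\mathit{inf}$ or $\mathit{sup}$: $Z=t$. - $(t_1\circ t_2)$, $\circ\in\{+,-,\times\}$: $\exists I J(Z=I\circ J\land \mathit{val}_{t_1}(I)\land \mathit{val}_{t_2}(J))$.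 - $(t_1/t_2)$: $\exists IJQR(I=J\times Q+R\land \mathit{val}_{t_1}(I)\land \mathit{val}_{t_2}(J)\land J\neq0\land R\ge 0\land R<Q\land Z=Q)$. - $(t_1\backslash t_2)$: $\exists IJQR(I=J\times Q+R\land \mathit{val}_{t_1}(I)\land \mathit{val}_{t_2}(J)\land J\neq0\land R\ge 0\land R<Q\land Z=R)$. - $(t_1\,..\,t_2)$: $\exists IJK(\mathit{val}_{t_1}(I)\land \mathit{val}_{t_2}(J)\land I\le K\land K\le J\land Z=K)$. - tuple $(t_1,\dots,t_k)$: $\exists I_1\dots I_k(Z=(I_1,\dots,I_k)\land \mathit{val}_{t_1}(I_1)\land\dots\land \mathit{val}_{t_k}(I_k))$. - pool $(t_1;\dots;t_k)$: $\exists I_1\dots I_k(\mathit{val}_{t_1}(I_1)\land\dots\land \mathit{val}_{t_k}(I_k)\land(Z=I_1\lor\dots\lor Z=I_k))$. **The translation $\tau^*$** (each $Z_i$ a fresh program variable). Body: $\tau^B(p(t_1,\dots,t_k))$ is $\exists Z_1\dots Z_k(\mathit{val}_{t_1}(Z_1)\land\dots\land \mathit{val}_{t_k}(Z_k)\land p(Z_1,\dots,Z_k))$; $\tau^B$ of $\mathit{not}\,p(t_1,\dots,t_k)$ and of $\mathit{not}\,\mathit{not}\,p(t_1,\dots,t_k)$ is the same with $\neg p(Z_1,\dots,Z_k)$, resp. $\neg\neg p(Z_1,\dots,Z_k)$, as the last conjunct; for $\ell$ being empty, $\mathit{not}$ or $\mathit{not}\,\mathit{not}$, $\tau^B(\ell\,p(\mathbf{t_1};\dots;\mathbf{t_k}))$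 is $\tau^B(\ell\,p(\mathbf{t_1}))\lor\dots\lor\tau^B(\ell\,p(\mathbf{t_k}))$; $\tau^B(t_1\sim t_2)$ is $\exists Z_1Z_2(\mathit{val}_{t_1}(Z_1)\land \mathit{val}_{t_2}(Z_2)\land Z_1\sim Z_2)$. Head: $\tau^H(p(t_1,\dots,t_k))$ is $\forall Z_1\dots Z_k(\mathit{val}_{t_1}(Z_1)\land\dots\land \mathit{val}_{t_k}(Z_k)\rightarrow p(Z_1,\dots,Z_k))$; $\tau^H(\{p(t_1,\dots,t_k)\})$ is the same with consequent $p(Z_1,\dots,Z_k)\lor\neg p(Z_1,\dots,Z_k)$; $\tau^H(p(\mathbf{t_1};\dots;\mathbf{t_k}))$ is $\tau^H(p(\mathbf{t_1}))\land\dots\land\tau^H(p(\mathbf{t_k}))$; $\tau^H(\{p(\mathbf{t_1};\dots;\mathbf{t_k})\})$ is $\tau^H(\{p(\mathbf{t_1})\})\land\dots\land\tau^H(\{p(\mathbf{t_k})\})$; $\tau^H$ of the empty head is $\bot$. $\tau^*(H\leftarrow B_1\land\dots\land B_n)$ is the universal closure of $\tau^B(B_1)\land\dots\land\tau^B(B_n)\rightarrow\tau^H(H)$ (empty conjunction is $\top$), and $\tau^*\Pi$ is the set of $\tau^*R$ for all rules $R$ of $\Pi$. **The transformation $\sigma^*$.** For each predicate $p$ introduce a new predicate $p'$ of the same arity; $F'$ is $F$ with every predicate $p$ replaced by $p'$ (comparisons unchanged). $\sigma^*(F)=F$ if $F$ is an atom, a comparison, $\top$ or $\bot$; $\sigma^*(F\circ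 G)=\sigma^*(F)\circ\sigma^*(G)$ for $\circ\in\{\land,\lor\}$; $\sigma^*(\neg F)=\neg F'$; $\sigma^*(F\rightarrow G)=(\sigma^*(F)\rightarrow\sigma^*(G))\land(F'\rightarrow G')$; $\sigma^*(\forall X F)=\forall X\sigma^*(F)$; $\sigma^*(\exists X F)=\exists X\sigma^*(F)$. For a set of formulas, $\sigma^*$ is applied elementwise. **Classical interpretations.** $\mathcal{P}'=\{p'(\mathbf{r})\mid p(\mathbf{r})\in\mathcal{P}\}$, disjoint from $\mathcal{P}$, and $\mathcal{A}=\{p(\mathbf{r})\rightarrow p'(\mathbf{r})\mid p(\mathbf{r})\in\mathcal{P}\}$. A standard classical interpretation over $\mathcal{P}\cup\mathcal{P}'$ is given by a subset $I\subseteq\mathcal{P}\cup\mathcal{P}'$ of true atoms: program variables range over all precomputed terms, integer variables over all numerals, each precomputed term denotes itself, and equality, arithmetic, tupling and comparisons are interpreted in the usual way (comparisons via the fixed order).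
   Formalization: Two val clauses corrected, as the printed ones make the claim false (p(1/2) vs p(0); p((0;1..0)) vs p(0)): for / and \, "R≥0, R<Q" becomes "0≤R<J or J<R≤0"; for pools, val is the disjunction of the members' val_{t_i}(Z). -}

module Defs where

open import Level using (0ℓ)
open import Data.Bool.Base using (Bool; true; false; if_then_else_)
open import Data.Empty using (⊥)
open import Data.Unit.Base using (⊤)
open import Data.Nat.Base as ℕ using (ℕ; zero; suc)
open import Data.Integer.Base as ℤ using (ℤ)
open import Data.Rational.Unnormalised.Base using (mkℚᵘ; _÷_; floor)
open import Data.Fin.Base using (Fin)
open import Data.Product.Base using (Σ; Σ-syntax; ∃; ∃-syntax; ∃₂; _×_; _,_)
open import Data.Sum.Base using (_⊎_)
open import Data.List.Base using (List; []; _∷_; _++_; length; lookup; map; replicate)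
open import Data.List.NonEmpty.Base as List⁺ using (List⁺; _∷_; toList)
open import Data.List.Membership.Propositional using (_∈_; _∉_)
open import Data.List.Relation.Unary.All as All using (All; []; _∷_)
open import Data.List.Relation.Unary.Any using (here; there)
open import Data.Vec.Base as Vec using (Vec; []; _∷_)
open import Function.Bundles using (_⇔_)
open import Relation.Binary.Core using (Rel)
open import Relation.Binary.Structures using (IsTotalOrder)
open import Relation.Binary.PropositionalEquality.Core using (_≡_; _≢_; refl)
open import Relation.Nullary.Negation.Core using (¬_)
open import Relation.Unary using (Pred; ｛_｝; _∪_; _⊂_)

data Precomputed (C : Set) : Set where
  num     : ℤ → Precomputed C
  symb    : C → Precomputed C
  inf sup : Precomputed C
  tup     : List (Precomputed C) → Precomputed C

record Signature : Set₁ where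
  infix 4 _≤_
  field
    Const        : Set
    infinite     : ∀ (cs : List Const) → ∃[ c ] c ∉ cs
    _≤_          : Rel (Precomputed Const) 0ℓ
    isTotalOrder : IsTotalOrder _≡_ _≤_
    inf-least    : ∀ r → inf ≤ r
    sup-greatest : ∀ r → r ≤ sup
    num-≤        : ∀ m n → num m ≤ num n ⇔ m ℤ.≤ n

data ArithOp : Set where
  add sub mul : ArithOp

⟦_⟧ᵒ : ArithOp → ℤ → ℤ → ℤ
⟦ add ⟧ᵒ = ℤ._+_
⟦ sub ⟧ᵒ = ℤ._-_
⟦ mul ⟧ᵒ = ℤ._*_

-- The division of Data.Integer rounds so that the remainder is non-negative;
-- for negative divisors this differs from the floor of the quotient.
⌊_/_⌋ : (m n : ℤ) .{{_ : ℤ.NonZero n}} → ℤ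
⌊ m / n ⌋ = floor (mkℚᵘ m 0 ÷ mkℚᵘ n 0)

data Comparison : Set where
  eq neq lt gt le ge : Comparison

data Prefix : Set where
  pos not notnot : Prefix

module _ (C : Set) where

  -- The index n is the number of program variables in scope.
  data Term (n : ℕ) : Set where
    num      : ℤ → Term n
    symb     : C → Term n
    var      : Fin n → Term n
    inf sup  : Term n
    arith    : ArithOp → Term n → Term n → Term n
    quot rem : Term n → Term n → Term n
    interval : Term n → Term n → Term n
    tuple    : List (Term n) → Term n
    pool     : List⁺ (Term n) → Term n

  record Atom (n : ℕ) : Set where
    constructor _⟨_⟩
    field
      symbol : C
      args   : List⁺ (List (Term n))

  data BodyExpr (n : ℕ) : Set where
    lit : Prefix → Atom n → BodyExpr n
    cmp : Comparison → Term n → Term n → BodyExpr n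

  data Head (n : ℕ) : Set where
    basic choice : Atom n → Head n
    empty        : Head n

  record Rule : Set where
    field
      vars : ℕ
      head : Head vars
      body : List (BodyExpr vars)

  Program : Set
  Program = List Rule

-- Two-sorted first-order formulas, in de Bruijn style: a context lists the
-- sorts of the free variables.  L is the set of predicate names; predicates
-- of the same name but with different numbers of arguments are different.
data Sort : Set where
  prog int : Sort

Ctx : Set
Ctx = List Sort

data FTerm (C : Set) (Γ : Ctx) : Sort → Set where
  con   : Precomputed C → FTerm C Γ prog
  num   : ℤ → FTerm C Γ int
  var   : ∀ {s} → s ∈ Γ → FTerm C Γ s
  arith : ArithOp → FTerm C Γ int → FTerm C Γ int → FTerm C Γ int
  ↑_    : FTerm C Γ int → FTerm C Γ prog
  tup   : List (FTerm C Γ prog) → FTerm C Γ prog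

infix  8 `_
infixr 7 _`∧_
infixr 6 _`∨_
infixr 5 _`⇒_

data Formula (C L : Set) (Γ : Ctx) : Set where
  atom     : L → List (FTerm C Γ prog) → Formula C L Γ
  cmp      : Comparison → FTerm C Γ prog → FTerm C Γ prog → Formula C L Γ
  `⊥ `⊤    : Formula C L Γ
  `¬_      : Formula C L Γ → Formula C L Γ
  _`∧_ _`∨_ _`⇒_ : Formula C L Γ → Formula C L Γ → Formula C L Γ
  `∀ `∃    : (s : Sort) → Formula C L (s ∷ Γ) → Formula C L Γ

module _ {C L : Set} where

  `∃* `∀* : ∀ {Γ} Δ → Formula C L (Δ ++ Γ) → Formula C L Γ
  `∃* []      F = F
  `∃* (s ∷ Δ) F = `∃* Δ (`∃ s F)
  `∀* []      F = F
  `∀* (s ∷ Δ) F = `∀* Δ (`∀ s F)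

  `⋀ `⋁ : ∀ {Γ} → List (Formula C L Γ) → Formula C L Γ
  `⋀ []       = `⊤
  `⋀ (F ∷ Fs) = F `∧ `⋀ Fs
  `⋁ []       = `⊥
  `⋁ (F ∷ Fs) = F `∨ `⋁ Fs

weaken : ∀ {Γ} Δ {s : Sort} → s ∈ Γ → s ∈ Δ ++ Γ
weaken []      x = x
weaken (_ ∷ Δ) x = there (weaken Δ x)

fresh : ∀ {Γ} k → Vec (prog ∈ replicate k prog ++ Γ) k
fresh zero    = []
fresh (suc k) = here refl ∷ Vec.map there (fresh k)

`_ : ∀ {C Γ s} → s ∈ Γ → FTerm C Γ prog
`_ {s = prog} x = var x
`_ {s = int}  x = ↑ var x

data Doubled (C : Set) : Set where
  plain primed : C → Doubled C

module _ {C : Set} where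

  prime : ∀ {Γ} → Formula C C Γ → Formula C (Doubled C) Γ
  prime (atom p ts) = atom (primed p) ts
  prime (cmp c t u) = cmp c t u
  prime `⊥          = `⊥
  prime `⊤          = `⊤
  prime (`¬ F)      = `¬ prime F
  prime (F `∧ G)    = prime F `∧ prime G
  prime (F `∨ G)    = prime F `∨ prime G
  prime (F `⇒ G)    = prime F `⇒ prime G
  prime (`∀ s F)    = `∀ s (prime F)
  prime (`∃ s F)    = `∃ s (prime F)

  σ* : ∀ {Γ} → Formula C C Γ → Formula C (Doubled C) Γ
  σ* (atom p ts) = atom (plain p) ts
  σ* (cmp c t u) = cmp c t u
  σ* `⊥          = `⊥
  σ* `⊤          = `⊤
  σ* (`¬ F)      = `¬ prime F
  σ* (F `∧ G)    = σ* F `∧ σ* G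
  σ* (F `∨ G)    = σ* F `∨ σ* G
  σ* (F `⇒ G)    = (σ* F `⇒ σ* G) `∧ (prime F `⇒ prime G)
  σ* (`∀ s F)    = `∀ s (σ* F)
  σ* (`∃ s F)    = `∃ s (σ* F)

module _ {C : Set} where

  -- ρ places the program variables of t in the context Γ.
  val  : ∀ {n Γ s} → (Fin n → prog ∈ Γ) → Term C n → s ∈ Γ → Formula C C Γ
  vals : ∀ {n Γ} → (Fin n → prog ∈ Γ) → (ts : List (Term C n)) →
         Vec (prog ∈ Γ) (length ts) → Formula C C Γ
  valPool : ∀ {n Γ s} → (Fin n → prog ∈ Γ) → List (Term C n) → s ∈ Γ → Formula C C Γ

  val ρ (num m) z = cmp eq (` z) (con (num m))
  val ρ (symb c) z = cmp eq (` z) (con (symb c))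
  val ρ (var x) z = cmp eq (` z) (` ρ x)
  val ρ inf     z = cmp eq (` z) (con inf)
  val ρ sup     z = cmp eq (` z) (con sup)
  val {Γ = Γ} ρ (arith o t u) z =
    `∃* Δ (cmp eq (` weaken Δ z) (↑ arith o (var I) (var J))
           `∧ val (λ x → weaken Δ (ρ x)) t I
           `∧ val (λ x → weaken Δ (ρ x)) u J)
    where
    Δ : Ctx
    Δ = int ∷ int ∷ []
    I J : int ∈ Δ ++ Γ
    I = here refl
    J = there (here refl)
  -- Floor division leaves a remainder R that is zero or has the sign of the
  -- divisor J, with |R| < |J|.  Bounding R by the quotient Q instead
  -- (0 ≤ R < Q) would leave 1/2 without a value.
  val {Γ = Γ} ρ (quot t u) z =
    `∃* Δ (cmp eq (` I) (↑ arith add (arith mul (var J) (var Q)) (var R))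
           `∧ val (λ x → weaken Δ (ρ x)) t I
           `∧ val (λ x → weaken Δ (ρ x)) u J
           `∧ cmp neq (` J) (↑ num (ℤ.+ 0))
           `∧ ((cmp ge (` R) (↑ num (ℤ.+ 0)) `∧ cmp lt (` R) (` J))
               `∨ (cmp le (` R) (↑ num (ℤ.+ 0)) `∧ cmp gt (` R) (` J)))
           `∧ cmp eq (` weaken Δ z) (` Q))
    where
    Δ : Ctx
    Δ = int ∷ int ∷ int ∷ int ∷ []
    I J Q R : int ∈ Δ ++ Γ
    I = here refl
    J = there (here refl)
    Q = there (there (here refl))
    R = there (there (there (here refl)))
  val {Γ = Γ} ρ (rem t u) z =
    `∃* Δ (cmp eq (` I) (↑ arith add (arith mul (var J) (var Q)) (var R))
           `∧ val (λ x → weaken Δ (ρ x)) t I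
           `∧ val (λ x → weaken Δ (ρ x)) u J
           `∧ cmp neq (` J) (↑ num (ℤ.+ 0))
           `∧ ((cmp ge (` R) (↑ num (ℤ.+ 0)) `∧ cmp lt (` R) (` J))
               `∨ (cmp le (` R) (↑ num (ℤ.+ 0)) `∧ cmp gt (` R) (` J)))
           `∧ cmp eq (` weaken Δ z) (` R))
    where
    Δ : Ctx
    Δ = int ∷ int ∷ int ∷ int ∷ []
    I J Q R : int ∈ Δ ++ Γ
    I = here refl
    J = there (here refl)
    Q = there (there (here refl))
    R = there (there (there (here refl)))
  val {Γ = Γ} ρ (interval t u) z =
    `∃* Δ (val (λ x → weaken Δ (ρ x)) t I
           `∧ val (λ x → weaken Δ (ρ x)) u J
           `∧ cmp le (` I) (` K)
           `∧ cmp le (` K) (` J)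
           `∧ cmp eq (` weaken Δ z) (` K))
    where
    Δ : Ctx
    Δ = int ∷ int ∷ int ∷ []
    I J K : int ∈ Δ ++ Γ
    I = here refl
    J = there (here refl)
    K = there (there (here refl))
  val ρ (tuple ts) z =
    `∃* Δ (cmp eq (` weaken Δ z) (tup (Vec.toList (Vec.map `_ Is)))
           `∧ vals (λ x → weaken Δ (ρ x)) ts Is)
    where
    Δ  = replicate (length ts) prog
    Is = fresh (length ts)
  -- A member of a pool may have no values at all, as 1..0 in (0; 1..0).
  -- Hence a disjunction of the val's, rather than values I₁,…,Iₖ of all
  -- members together with Z = I₁ ∨ … ∨ Z = Iₖ.
  val ρ (pool (t ∷ ts)) z = val ρ t z `∨ valPool ρ ts z

  vals ρ []       []       = `⊤
  vals ρ (t ∷ ts) (z ∷ zs) = val ρ t z `∧ vals ρ ts zs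

  valPool ρ []       z = `⊥
  valPool ρ (t ∷ ts) z = val ρ t z `∨ valPool ρ ts z

  signed : ∀ {Γ} → Prefix → Formula C C Γ → Formula C C Γ
  signed pos    F = F
  signed not    F = `¬ F
  signed notnot F = `¬ `¬ F

  τᴮ : ∀ {n Γ} → (Fin n → prog ∈ Γ) → BodyExpr C n → Formula C C Γ
  τᴮ {n} {Γ} ρ (lit ℓ (p ⟨ tss ⟩)) = `⋁ (map member (toList tss))
    where
    member : List (Term C n) → Formula C C Γ
    member ts = `∃* Δ (vals (λ x → weaken Δ (ρ x)) ts Zs
                       `∧ signed ℓ (atom p (Vec.toList (Vec.map `_ Zs))))
      where
      Δ  = replicate (length ts) prog
      Zs = fresh (length ts)
  τᴮ {Γ = Γ} ρ (cmp c t u) =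
    `∃* Δ (val (λ x → weaken Δ (ρ x)) t Z₁
           `∧ val (λ x → weaken Δ (ρ x)) u Z₂
           `∧ cmp c (` Z₁) (` Z₂))
    where
    Δ : Ctx
    Δ = prog ∷ prog ∷ []
    Z₁ Z₂ : prog ∈ Δ ++ Γ
    Z₁ = here refl
    Z₂ = there (here refl)

  τᴴ : ∀ {n Γ} → (Fin n → prog ∈ Γ) → Head C n → Formula C C Γ
  τᴴ {n} {Γ} ρ (basic (p ⟨ tss ⟩)) = `⋀ (map member (toList tss))
    where
    member : List (Term C n) → Formula C C Γ
    member ts = `∀* Δ (vals (λ x → weaken Δ (ρ x)) ts Zs
                       `⇒ atom p (Vec.toList (Vec.map `_ Zs)))
      where
      Δ  = replicate (length ts) prog
      Zs = fresh (length ts)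
  τᴴ {n} {Γ} ρ (choice (p ⟨ tss ⟩)) = `⋀ (map member (toList tss))
    where
    member : List (Term C n) → Formula C C Γ
    member ts = `∀* Δ (vals (λ x → weaken Δ (ρ x)) ts Zs
                       `⇒ atom p (Vec.toList (Vec.map `_ Zs))
                          `∨ `¬ atom p (Vec.toList (Vec.map `_ Zs)))
      where
      Δ  = replicate (length ts) prog
      Zs = fresh (length ts)
  τᴴ ρ empty = `⊥

  τ*ᴿ : Rule C → Formula C C []
  τ*ᴿ R = `∀* (replicate vars prog) (`⋀ (map (τᴮ ρ) body) `⇒ τᴴ ρ head)
    where
    open Rule R
    ρ : Fin vars → prog ∈ replicate vars prog ++ []
    ρ = Vec.lookup (fresh vars)

  τ* : Program C → List (Formula C C [])
  τ* = map τ*ᴿ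

data Infinitary (P : Set) : Set₁ where
  atom : P → Infinitary P
  ⋀ ⋁  : (A : Set) → (A → Infinitary P) → Infinitary P
  ¬′_  : Infinitary P → Infinitary P
  _⇒′_ : Infinitary P → Infinitary P → Infinitary P

module _ {P : Set} where

  ⊥′ : Infinitary P
  ⊥′ = ⋁ ⊥ λ ()

  ⊤′ : Infinitary P
  ⊤′ = ⋀ ⊥ λ ()

  _∨′_ : Infinitary P → Infinitary P → Infinitary P
  F ∨′ G = ⋁ Bool λ b → if b then F else G

  ⋀ₗ ⋁ₗ : ∀ {A : Set} → List A → (A → Infinitary P) → Infinitary P
  ⋀ₗ xs F = ⋀ (Fin (length xs)) (λ i → F (lookup xs i))
  ⋁ₗ xs F = ⋁ (Fin (length xs)) (λ i → F (lookup xs i))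

  -- ⊤ if A holds and ⊥ otherwise: the disjunction of the set {⊤ | A}.
  ⌜_⌝ : Set → Infinitary P
  ⌜ A ⌝ = ⋁ A λ _ → ⊤′

  infix 3 ⟨_,_⟩⊨_

  ⟨_,_⟩⊨_ : Pred P 0ℓ → Pred P 0ℓ → Infinitary P → Set
  ⟨ H , T ⟩⊨ atom p   = H p
  ⟨ H , T ⟩⊨ ⋀ A F    = ∀ a → ⟨ H , T ⟩⊨ F a
  ⟨ H , T ⟩⊨ ⋁ A F    = ∃ λ a → ⟨ H , T ⟩⊨ F a
  ⟨ H , T ⟩⊨ (¬′ F)   = ¬ (⟨ T , T ⟩⊨ F)
  ⟨ H , T ⟩⊨ (F ⇒′ G) = (⟨ H , T ⟩⊨ F → ⟨ H , T ⟩⊨ G) × (⟨ T , T ⟩⊨ F → ⟨ T , T ⟩⊨ G)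

Theory : Set → Set₁
Theory P = Σ[ A ∈ Set ] (A → Infinitary P)

module _ {P : Set} where

  infix 3 ⟨_,_⟩⊨ᵗ_

  ⟨_,_⟩⊨ᵗ_ : Pred P 0ℓ → Pred P 0ℓ → Theory P → Set
  ⟨ H , T ⟩⊨ᵗ (A , F) = ∀ a → ⟨ H , T ⟩⊨ F a

  Stable : Theory P → Pred P 0ℓ → Set₁
  Stable Φ X = (⟨ X , X ⟩⊨ᵗ Φ) × (∀ (Y : Pred P 0ℓ) → Y ⊂ X → ¬ (⟨ Y , X ⟩⊨ᵗ Φ))

GroundAtom : Set → Set → Set
GroundAtom C L = L × List (Precomputed C)

module _ {C : Set} where

  embed  : ∀ {n} → Precomputed C → Term C n
  embeds : ∀ {n} → List (Precomputed C) → List (Term C n)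
  embed (num m)  = num m
  embed (symb c)  = symb c
  embed inf      = inf
  embed sup      = sup
  embed (tup rs) = tuple (embeds rs)
  embeds []       = []
  embeds (r ∷ rs) = embed r ∷ embeds rs

  module _ {n : ℕ} (θ : Fin n → Precomputed C) where

    substTerm  : Term C n → Term C 0
    substTerms : List (Term C n) → List (Term C 0)
    substTerm (num m)         = num m
    substTerm (symb c)         = symb c
    substTerm (var x)         = embed (θ x)
    substTerm inf             = inf
    substTerm sup             = sup
    substTerm (arith o t u)   = arith o (substTerm t) (substTerm u)
    substTerm (quot t u)      = quot (substTerm t) (substTerm u)
    substTerm (rem t u)       = rem (substTerm t) (substTerm u)
    substTerm (interval t u)  = interval (substTerm t) (substTerm u)
    substTerm (tuple ts)      = tuple (substTerms ts)
    substTerm (pool (t ∷ ts)) = pool (substTerm t ∷ substTerms ts)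
    substTerms []       = []
    substTerms (t ∷ ts) = substTerm t ∷ substTerms ts

    substAtom : Atom C n → Atom C 0
    substAtom (p ⟨ tss ⟩) = p ⟨ List⁺.map substTerms tss ⟩

    substBody : BodyExpr C n → BodyExpr C 0
    substBody (lit ℓ A)   = lit ℓ (substAtom A)
    substBody (cmp c t u) = cmp c (substTerm t) (substTerm u)

    substHead : Head C n → Head C 0
    substHead (basic A)  = basic (substAtom A)
    substHead (choice A) = choice (substAtom A)
    substHead empty      = empty

  values    : Term C 0 → Pred (Precomputed C) 0ℓ
  tupValues : List (Term C 0) → Pred (List (Precomputed C)) 0ℓ
  anyValues : List (Term C 0) → Pred (Precomputed C) 0ℓ

  values (num m) = ｛ num m ｝
  values (symb c) = ｛ symb c ｝
  values inf     = ｛ inf ｝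
  values sup     = ｛ sup ｝
  values (arith o t u) r = ∃₂ λ n₁ n₂ →
    values t (num n₁) × values u (num n₂) × r ≡ num (⟦ o ⟧ᵒ n₁ n₂)
  values (quot t u) r = ∃₂ λ n₁ n₂ →
    values t (num n₁) × values u (num n₂) ×
    Σ[ nz ∈ ℤ.NonZero n₂ ] r ≡ num (⌊ n₁ / n₂ ⌋ {{nz}})
  values (rem t u) r = ∃₂ λ n₁ n₂ →
    values t (num n₁) × values u (num n₂) ×
    Σ[ nz ∈ ℤ.NonZero n₂ ] r ≡ num (n₁ ℤ.- n₂ ℤ.* ⌊ n₁ / n₂ ⌋ {{nz}})
  values (interval t u) r = ∃[ n₁ ] ∃[ n₂ ] ∃[ m ]
    values t (num n₁) × values u (num n₂) × n₁ ℤ.≤ m × m ℤ.≤ n₂ × r ≡ num m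
  values (tuple ts) r = ∃[ rs ] tupValues ts rs × r ≡ tup rs
  values (pool (t ∷ ts)) = values t ∪ anyValues ts

  tupValues []       []       = ⊤
  tupValues (t ∷ ts) (r ∷ rs) = values t r × tupValues ts rs
  tupValues []       (_ ∷ _)  = ⊥
  tupValues (_ ∷ _)  []       = ⊥

  anyValues []       r = ⊥
  anyValues (t ∷ ts) = values t ∪ anyValues ts

module Semantics (𝓢 : Signature) where

  open Signature 𝓢 public
  open import Relation.Binary.Construct.NonStrictToStrict _≡_ _≤_ using (_<_)

  ⟦_⟧ᶜ : Comparison → Rel (Precomputed Const) 0ℓ
  ⟦ eq  ⟧ᶜ r₁ r₂ = r₁ ≡ r₂
  ⟦ neq ⟧ᶜ r₁ r₂ = r₁ ≢ r₂
  ⟦ lt  ⟧ᶜ r₁ r₂ = r₁ < r₂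
  ⟦ gt  ⟧ᶜ r₁ r₂ = r₂ < r₁
  ⟦ le  ⟧ᶜ r₁ r₂ = r₁ ≤ r₂
  ⟦ ge  ⟧ᶜ r₁ r₂ = r₂ ≤ r₁

  𝒫 : Set
  𝒫 = GroundAtom Const Const

  signed′ : Prefix → Infinitary 𝒫 → Infinitary 𝒫
  signed′ pos    F = F
  signed′ not    F = ¬′ F
  signed′ notnot F = ¬′ (¬′ F)

  bodyFormula : BodyExpr Const 0 → Infinitary 𝒫
  bodyFormula (lit ℓ (p ⟨ tss ⟩)) =
    ⋁ₗ (toList tss) λ ts → ⋁ (∃ (tupValues ts)) λ (rs , _) → signed′ ℓ (atom (p , rs))
  bodyFormula (cmp c t u) =
    ⌜ (∃₂ λ r₁ r₂ → values t r₁ × values u r₂ × ⟦ c ⟧ᶜ r₁ r₂) ⌝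

  headFormula : Head Const 0 → Infinitary 𝒫
  headFormula (basic (p ⟨ tss ⟩)) =
    ⋀ₗ (toList tss) λ ts → ⋀ (∃ (tupValues ts)) λ (rs , _) → atom (p , rs)
  headFormula (choice (p ⟨ tss ⟩)) =
    ⋀ₗ (toList tss) λ ts → ⋀ (∃ (tupValues ts)) λ (rs , _) →
      atom (p , rs) ∨′ (¬′ atom (p , rs))
  headFormula empty = ⊥′

  instanceFormula : (R : Rule Const) → (Fin (Rule.vars R) → Precomputed Const) → Infinitary 𝒫
  instanceFormula R θ = ⋀ₗ (map (substBody θ) body) bodyFormula ⇒′ headFormula (substHead θ head)
    where open Rule R

  τ : Program Const → Theory 𝒫
  τ Π = (Σ[ R ∈ Rule Const ] R ∈ Π × (Fin (Rule.vars R) → Precomputed Const))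
      , λ (R , _ , θ) → instanceFormula R θ

  AnswerSet : Program Const → Pred 𝒫 0ℓ → Set₁
  AnswerSet Π = Stable (τ Π)

  StronglyEquivalent : Program Const → Program Const → Set₁
  StronglyEquivalent Π₁ Π₂ = ∀ (Π : Program Const) (X : Pred 𝒫 0ℓ) →
    AnswerSet (Π₁ ++ Π) X ⇔ AnswerSet (Π₂ ++ Π) X

  Dom : Sort → Set
  Dom prog = Precomputed Const
  Dom int  = ℤ

  Env : Ctx → Set
  Env = All Dom

  eval  : ∀ {Γ s} → Env Γ → FTerm Const Γ s → Dom s
  evals : ∀ {Γ} → Env Γ → List (FTerm Const Γ prog) → List (Precomputed Const)
  eval ε (con r)       = r
  eval ε (num m)       = m
  eval ε (var x)       = All.lookup ε x
  eval ε (arith o t u) = ⟦ o ⟧ᵒ (eval ε t) (eval ε u)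
  eval ε (↑ t)         = num (eval ε t)
  eval ε (tup ts)      = tup (evals ε ts)
  evals ε []       = []
  evals ε (t ∷ ts) = eval ε t ∷ evals ε ts

  Interpretation : Set₁
  Interpretation = Pred (GroundAtom Const (Doubled Const)) 0ℓ

  infix 4 _⊨[_]_ _⊨_ _⊨ˢ_ _⊨𝒜

  _⊨[_]_ : ∀ {Γ} → Interpretation → Env Γ → Formula Const (Doubled Const) Γ → Set
  I ⊨[ ε ] atom p ts = I (p , evals ε ts)
  I ⊨[ ε ] cmp c t u = ⟦ c ⟧ᶜ (eval ε t) (eval ε u)
  I ⊨[ ε ] `⊥        = ⊥
  I ⊨[ ε ] `⊤        = ⊤
  I ⊨[ ε ] (`¬ F)    = ¬ (I ⊨[ ε ] F)
  I ⊨[ ε ] (F `∧ G)  = (I ⊨[ ε ] F) × (I ⊨[ ε ] G)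
  I ⊨[ ε ] (F `∨ G)  = (I ⊨[ ε ] F) ⊎ (I ⊨[ ε ] G)
  I ⊨[ ε ] (F `⇒ G)  = (I ⊨[ ε ] F) → (I ⊨[ ε ] G)
  I ⊨[ ε ] `∀ s F    = ∀ d → I ⊨[ d ∷ ε ] F
  I ⊨[ ε ] `∃ s F    = ∃ λ d → I ⊨[ d ∷ ε ] F

  _⊨_ : Interpretation → Formula Const (Doubled Const) [] → Set
  I ⊨ F = I ⊨[ [] ] F

  _⊨ˢ_ : Interpretation → List (Formula Const (Doubled Const) []) → Set
  I ⊨ˢ Fs = All (I ⊨_) Fs

  𝒜 : 𝒫 → Formula Const (Doubled Const) []
  𝒜 (p , rs) = atom (plain p) (map con rs) `⇒ atom (primed p) (map con rs)

  _⊨𝒜 : Interpretation → Set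
  I ⊨𝒜 = ∀ a → I ⊨ 𝒜 a

{-# OPTIONS --safe #-}

-- An interpretation I of the doubled signature that satisfies 𝒜 is the same
-- thing as a here-and-there pair H ⊆ T, and σ* spells out here-and-there
-- satisfaction; so the classical side says that τ Π₁ and τ Π₂ have the same
-- here-and-there models, which gives strong equivalence at once.
--
-- Conversely, programs are finite, so a pair H ⊆ T of infinite sets cannot be
-- written down as facts and rules.  Instead it is encoded in the candidate
-- answer set: with a fresh constant h, where h(p,𝐗) marks the atoms p(𝐗) of
-- H and h() says that H ≠ T, the context program consists of the rules
--   {h(p,𝐗)},   p(𝐗) ← h(p,𝐗),   h() ← p(𝐗) ∧ not h(p,𝐗),
--   p(𝐗) ← h() ∧ not not p(𝐗)
-- for the finitely many predicates p of Π₁ and Π₂.  Below the encoding of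
-- (H , T), its only possible proper here-world is the encoding of H alone.

module Submission where

open import Level using (0ℓ)
open import Axiom.ExcludedMiddle using (ExcludedMiddle)
open import Data.Bool.Base using (true; false)
open import Data.Empty using (⊥; ⊥-elim)
open import Data.Unit.Base using (⊤; tt)
open import Data.Nat.Base as ℕ using (ℕ; zero; suc)
import Data.Nat.Properties as ℕ
open import Data.Integer.Base as ℤ using (ℤ; +_; -[1+_]; +[1+_])
import Data.Integer.Properties as ℤ
open import Data.Integer.DivMod using (_/ℕ_; _%ℕ_; n%ℕd<d; a≡a%ℕn+[a/ℕn]*n; div-pos-is-/ℕ)
open import Data.Integer.Tactic.RingSolver using (solve-∀)
open import Data.Fin.Base using (Fin; zero; suc)
open import Data.Product.Base as Product using (∃; _×_; _,_; proj₁; proj₂)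
open import Data.Product.Function.NonDependent.Propositional using (_×-⇔_)
open import Data.Sum.Base as Sum using (_⊎_; inj₁; inj₂; [_,_])
open import Data.Sum.Function.Propositional using (_⊎-⇔_)
open import Data.List.Base
  using (List; []; _∷_; _++_; concatMap; length; lookup; map; replicate; tabulate)
open import Data.List.Properties using (length-tabulate; tabulate-lookup)
open import Data.List.NonEmpty.Base using (_∷_; toList)
open import Data.List.Membership.Propositional using (_∈_; _∉_; find; lose)
import Data.List.Membership.Propositional.Properties as ∈
open import Data.List.Relation.Binary.Subset.Propositional using () renaming (_⊆_ to _⊆ₗ_)
open import Data.List.Relation.Unary.All as All using ([]; _∷_)
import Data.List.Relation.Unary.All.Properties as All
open import Data.List.Relation.Unary.Any using (here; there)
open import Data.Vec.Base as Vec using (Vec; []; _∷_)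
import Data.Vec.Properties as Vec
open import Function.Base using (_∘_; id)
open import Function.Bundles using (_⇔_; mk⇔; module Equivalence)
import Function.Properties.Equivalence as ⇔
open import Function.Related.TypeIsomorphisms using (→-cong-⇔; ¬-cong-⇔)
open import Relation.Binary.Definitions using (tri<; tri≈; tri>)
open import Relation.Binary.PropositionalEquality using (_≡_; refl; sym; trans; cong; cong₂; subst)
open import Relation.Nullary.Decidable using (yes; no; decidable-stable; toSum)
open import Relation.Nullary.Negation using (¬_; contradiction)
open import Relation.Unary using (Pred; _⊆_; _⊂_)
open import Defs
open Equivalence using (to; from)

-- Floor division

⌊/pos⌋ : ∀ m n → ⌊ m / +[1+ n ] ⌋ ≡ m /ℕ suc n
⌊/pos⌋ m n rewrite ℤ.*-identityʳ m | ℕ.+-identityʳ n = div-pos-is-/ℕ m (suc n)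

-- Division multiplies by the reciprocal, and the reciprocal of `-[1+ n ]` keeps its sign in the
-- numerator; the floor is therefore taken of `- m` over the positive denominator `suc n`.
⌊/neg⌋ : ∀ m n → ⌊ m / -[1+ n ] ⌋ ≡ (ℤ.- m) /ℕ suc n
⌊/neg⌋ m n rewrite ℤ.*-comm m (ℤ.- (+ 1)) | ℤ.-1*i≡-i m | ℕ.+-identityʳ n =
  div-pos-is-/ℕ (ℤ.- m) (suc n)

Remainder : ℤ → ℤ → Set
Remainder j r = (+ 0 ℤ.≤ r × r ℤ.< j) ⊎ (r ℤ.≤ + 0 × j ℤ.< r)

-- For a positive divisor this is the natural remainder of `i`; for a negative one it is the negated
-- natural remainder of `- i`, which lies between the divisor and 0.
⌊/⌋-remainder : ∀ i j .{{_ : ℤ.NonZero j}} → Remainder j (i ℤ.- j ℤ.* ⌊ i / j ⌋)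
⌊/⌋-remainder i +[1+ n ] rewrite ⌊/pos⌋ i n =
  inj₁ ( subst (+ 0 ℤ.≤_) (sym e) (ℤ.+≤+ ℕ.z≤n)
       , subst (ℤ._< +[1+ n ]) (sym e) (ℤ.+<+ (n%ℕd<d i (suc n))))
  where
  solved : ∀ r q d → (r ℤ.+ q ℤ.* d) ℤ.- d ℤ.* q ≡ r
  solved = solve-∀
  e : i ℤ.- +[1+ n ] ℤ.* (i /ℕ suc n) ≡ + (i %ℕ suc n)
  e = trans (cong (ℤ._- +[1+ n ] ℤ.* (i /ℕ suc n)) (a≡a%ℕn+[a/ℕn]*n i (suc n)))
             (solved (+ (i %ℕ suc n)) (i /ℕ suc n) +[1+ n ])
⌊/⌋-remainder i -[1+ n ] rewrite ⌊/neg⌋ i n =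
  inj₂ ( subst (ℤ._≤ + 0) (sym e) (ℤ.neg-mono-≤ (ℤ.+≤+ ℕ.z≤n))
       , subst (-[1+ n ] ℤ.<_) (sym e) (ℤ.neg-mono-< (ℤ.+<+ (n%ℕd<d (ℤ.- i) (suc n)))))
  where
  q = (ℤ.- i) /ℕ suc n
  solved : ∀ r q d → ℤ.- (r ℤ.+ q ℤ.* d) ℤ.- (ℤ.- d) ℤ.* q ≡ ℤ.- r
  solved = solve-∀
  e : i ℤ.- -[1+ n ] ℤ.* q ≡ ℤ.- (+ ((ℤ.- i) %ℕ suc n))
  e = trans (cong (ℤ._- -[1+ n ] ℤ.* q)
               (trans (sym (ℤ.neg-involutive i)) (cong ℤ.-_ (a≡a%ℕn+[a/ℕn]*n (ℤ.- i) (suc n)))))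
             (solved (+ ((ℤ.- i) %ℕ suc n)) q +[1+ n ])

-- If `q` is smaller by at least 1, the product falls short by at least `j`, and `r < j` cannot make
-- that up.
quotient-≮ : ∀ {j q r q′ r′} → + 0 ℤ.≤ j → + 0 ℤ.≤ r′ → r ℤ.< j →
             j ℤ.* q ℤ.+ r ≡ j ℤ.* q′ ℤ.+ r′ → ¬ q ℤ.< q′
quotient-≮ {j} {q} {r} {q′} {r′} j≥0 0≤r′ r<j e q<q′ = ℤ.<-irrefl e (begin-strict
  j ℤ.* q ℤ.+ r       <⟨ ℤ.+-monoʳ-< (j ℤ.* q) r<j ⟩
  j ℤ.* q ℤ.+ j       ≡⟨ solved j q ⟩
  j ℤ.* ℤ.suc q       ≤⟨ ℤ.*-monoˡ-≤-nonNeg j {{ℤ.nonNegative j≥0}} (ℤ.i<j⇒suc[i]≤j q<q′) ⟩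
  j ℤ.* q′            ≡⟨ ℤ.+-identityʳ (j ℤ.* q′) ⟨
  j ℤ.* q′ ℤ.+ + 0    ≤⟨ ℤ.+-monoʳ-≤ (j ℤ.* q′) 0≤r′ ⟩
  j ℤ.* q′ ℤ.+ r′     ∎)
  where
  open ℤ.≤-Reasoning
  solved : ∀ j q → j ℤ.* q ℤ.+ j ≡ j ℤ.* (+ 1 ℤ.+ q)
  solved = solve-∀

quotient-unique⁺ : ∀ {j q r q′ r′} → + 0 ℤ.≤ r → r ℤ.< j → + 0 ℤ.≤ r′ → r′ ℤ.< j →
                   j ℤ.* q ℤ.+ r ≡ j ℤ.* q′ ℤ.+ r′ → q ≡ q′
quotient-unique⁺ {j} {q} {r} {q′} {r′} 0≤r r<j 0≤r′ r′<j e with ℤ.<-cmp q q′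
... | tri< q<q′ _ _ = contradiction q<q′ (quotient-≮ (ℤ.<⇒≤ (ℤ.≤-<-trans 0≤r r<j)) 0≤r′ r<j e)
... | tri≈ _ q≡q′ _ = q≡q′
... | tri> _ _ q′<q =
  contradiction q′<q (quotient-≮ (ℤ.<⇒≤ (ℤ.≤-<-trans 0≤r r<j)) 0≤r r′<j (sym e))

-- The two mixed cases would make `j` both positive and negative. The case of a negative divisor
-- reduces to the positive one by negating `j` and both remainders.
quotient-unique : ∀ {j q r q′ r′} → Remainder j r → Remainder j r′ →
                  j ℤ.* q ℤ.+ r ≡ j ℤ.* q′ ℤ.+ r′ → q ≡ q′
quotient-unique (inj₁ (0≤r , r<j)) (inj₁ (0≤r′ , r′<j)) e = quotient-unique⁺ 0≤r r<j 0≤r′ r′<j e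
quotient-unique (inj₁ (0≤r , r<j)) (inj₂ (r′≤0 , j<r′)) _ =
  contradiction (ℤ.≤-<-trans 0≤r r<j) (ℤ.<-asym (ℤ.<-≤-trans j<r′ r′≤0))
quotient-unique (inj₂ (r≤0 , j<r)) (inj₁ (0≤r′ , r′<j)) _ =
  contradiction (ℤ.≤-<-trans 0≤r′ r′<j) (ℤ.<-asym (ℤ.<-≤-trans j<r r≤0))
quotient-unique {j} {q} {r} {q′} {r′} (inj₂ (r≤0 , j<r)) (inj₂ (r′≤0 , j<r′)) e =
  quotient-unique⁺ (ℤ.neg-mono-≤ r≤0) (ℤ.neg-mono-< j<r) (ℤ.neg-mono-≤ r′≤0) (ℤ.neg-mono-< j<r′)
    (trans (solved j q r) (trans (cong ℤ.-_ e) (sym (solved j q′ r′))))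
  where
  solved : ∀ j q r → (ℤ.- j) ℤ.* q ℤ.+ ℤ.- r ≡ ℤ.- (j ℤ.* q ℤ.+ r)
  solved = solve-∀

dividend : ∀ i j q → i ≡ j ℤ.* q ℤ.+ (i ℤ.- j ℤ.* q)
dividend = solve-∀

remainder : ∀ j q r → (j ℤ.* q ℤ.+ r) ℤ.- j ℤ.* q ≡ r
remainder = solve-∀

-- The floor quotient with its remainder is one decomposition of `i`, and any other has the same
-- quotient. This turns the existential clauses of `val` for `quot` and `rem` into values.
⌊/⌋-unique : ∀ {i j q r} .{{_ : ℤ.NonZero j}} → i ≡ j ℤ.* q ℤ.+ r → Remainder j r → q ≡ ⌊ i / j ⌋
⌊/⌋-unique {i} {j} {q} {r} e ρ =
  quotient-unique ρ (⌊/⌋-remainder i j) (trans (sym e) (dividend i j ⌊ i / j ⌋))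

remainder-unique : ∀ {i j q r} .{{_ : ℤ.NonZero j}} → i ≡ j ℤ.* q ℤ.+ r → Remainder j r →
                   r ≡ i ℤ.- j ℤ.* ⌊ i / j ⌋
remainder-unique {i} {j} {q} {r} refl ρ =
  trans (sym (remainder j q r)) (cong (λ x → i ℤ.- j ℤ.* x) (⌊/⌋-unique refl ρ))

-- Classical satisfaction of σ* (τ* Π) as here-and-there satisfaction of τ Π

∀-⇔ : {A : Set} {P Q : A → Set} → (∀ a → P a ⇔ Q a) → (∀ a → P a) ⇔ (∀ a → Q a)
∀-⇔ P⇔Q = mk⇔ (λ p a → to (P⇔Q a) (p a)) (λ q a → from (P⇔Q a) (q a))

∃-⇔ : {A : Set} {P Q : A → Set} → (∀ a → P a ⇔ Q a) → ∃ P ⇔ ∃ Q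
∃-⇔ P⇔Q = mk⇔ (λ (a , p) → a , to (P⇔Q a) p) (λ (a , q) → a , from (P⇔Q a) q)

sym-⇔ : {A : Set} {x y : A} → x ≡ y ⇔ y ≡ x
sym-⇔ = mk⇔ sym sym

num-injective : ∀ {C} {m n} → _≡_ {A = Precomputed C} (num m) (num n) → m ≡ n
num-injective refl = refl

module _ {C : Set} where

  -- Instances put `embed (θ x)` for a variable, whereas `val` equates `Z` with the variable itself;
  -- this reconciles the two.
  values-embed     : (r : Precomputed C) {r′ : Precomputed C} → values (embed r) r′ ⇔ r ≡ r′
  tupValues-embeds : (rs : List (Precomputed C)) {rs′ : List (Precomputed C)} →
                     tupValues (embeds rs) rs′ ⇔ rs ≡ rs′
  values-embed (num m)  = ⇔.refl
  values-embed (symb c) = ⇔.refl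
  values-embed inf      = ⇔.refl
  values-embed sup      = ⇔.refl
  values-embed (tup rs) =
    mk⇔ (λ { (_ , v , refl) → cong tup (to (tupValues-embeds rs) v) })
        (λ { refl → rs , from (tupValues-embeds rs) refl , refl })
  tupValues-embeds []       {[]}     = mk⇔ (λ _ → refl) (λ _ → tt)
  tupValues-embeds []       {_ ∷ _}  = mk⇔ (λ ()) (λ ())
  tupValues-embeds (r ∷ rs) {[]}     = mk⇔ (λ ()) (λ ())
  tupValues-embeds (r ∷ rs) {_ ∷ _}  =
    mk⇔ (λ (v , vs) → cong₂ _∷_ (to (values-embed r) v) (to (tupValues-embeds rs) vs))
        (λ { refl → from (values-embed r) refl , from (tupValues-embeds rs) refl })

  tupValues-length : (ts : List (Term C 0)) {rs : List (Precomputed C)} → tupValues ts rs → length rs ≡ length ts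
  tupValues-length []       {[]}    _        = refl
  tupValues-length (_ ∷ ts) {_ ∷ _} (_ , vs) = cong suc (tupValues-length ts vs)

  length-substTerms : ∀ {n} (θ : Fin n → Precomputed C) ts → length (substTerms θ ts) ≡ length ts
  length-substTerms θ []       = refl
  length-substTerms θ (_ ∷ ts) = cong suc (length-substTerms θ ts)

  substTerms-length : ∀ {n} (θ : Fin n → Precomputed C) ts {rs} →
                      tupValues (substTerms θ ts) rs → length rs ≡ length ts
  substTerms-length θ ts vs = trans (tupValues-length (substTerms θ ts) vs) (length-substTerms θ ts)

module Correspondence (𝓢 : Signature) where

  open Semantics 𝓢

  num-<⇒< : ∀ {m n} → ⟦ lt ⟧ᶜ (num m) (num n) → m ℤ.< n
  num-<⇒< (m≤n , m≢n) = ℤ.≤∧≢⇒< (to (num-≤ _ _) m≤n) (m≢n ∘ cong num)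

  <⇒num-< : ∀ {m n} → m ℤ.< n → ⟦ lt ⟧ᶜ (num m) (num n)
  <⇒num-< m<n = from (num-≤ _ _) (ℤ.<⇒≤ m<n) , λ e → ℤ.<-irrefl (num-injective e) m<n

  remainder-⇔ : ∀ {j r} → ((⟦ ge ⟧ᶜ (num r) (num (+ 0)) × ⟦ lt ⟧ᶜ (num r) (num j)) ⊎
                           (⟦ le ⟧ᶜ (num r) (num (+ 0)) × ⟦ gt ⟧ᶜ (num r) (num j))) ⇔ Remainder j r
  remainder-⇔ = (num-≤ _ _ ×-⇔ mk⇔ num-<⇒< <⇒num-<) ⊎-⇔ (num-≤ _ _ ×-⇔ mk⇔ num-<⇒< <⇒num-<)

  worldᴴ worldᵀ : Interpretation → Pred 𝒫 0ℓ
  worldᴴ I (p , rs) = I (plain p , rs)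
  worldᵀ I (p , rs) = I (primed p , rs)

  -- The interpretation that represents ⟨ worldᵀ I , worldᵀ I ⟩.
  collapse : Interpretation → Interpretation
  collapse I (plain p  , rs) = I (primed p , rs)
  collapse I (primed p , rs) = I (primed p , rs)

  -- Under `collapse I` both copies of a predicate mean the primed one, so `σ*` and `prime` no
  -- longer differ. Facts about `σ*` proved for every interpretation thus also cover the primed
  -- conjunct of an implication.
  prime⇔σ* : ∀ {Γ} I (ε : Env Γ) F → I ⊨[ ε ] prime F ⇔ collapse I ⊨[ ε ] σ* F
  prime⇔prime : ∀ {Γ} I (ε : Env Γ) F → I ⊨[ ε ] prime F ⇔ collapse I ⊨[ ε ] prime F

  prime⇔prime I ε (atom p ts) = ⇔.refl
  prime⇔prime I ε (cmp c t u) = ⇔.refl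
  prime⇔prime I ε `⊥          = ⇔.refl
  prime⇔prime I ε `⊤          = ⇔.refl
  prime⇔prime I ε (`¬ F)      = ¬-cong-⇔ (prime⇔prime I ε F)
  prime⇔prime I ε (F `∧ G)    = prime⇔prime I ε F ×-⇔ prime⇔prime I ε G
  prime⇔prime I ε (F `∨ G)    = prime⇔prime I ε F ⊎-⇔ prime⇔prime I ε G
  prime⇔prime I ε (F `⇒ G)    = →-cong-⇔ (prime⇔prime I ε F) (prime⇔prime I ε G)
  prime⇔prime I ε (`∀ s F)    = ∀-⇔ λ d → prime⇔prime I (d ∷ ε) F
  prime⇔prime I ε (`∃ s F)    = ∃-⇔ λ d → prime⇔prime I (d ∷ ε) F

  prime⇔σ* I ε (atom p ts) = ⇔.refl
  prime⇔σ* I ε (cmp c t u) = ⇔.refl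
  prime⇔σ* I ε `⊥          = ⇔.refl
  prime⇔σ* I ε `⊤          = ⇔.refl
  prime⇔σ* I ε (`¬ F)      = ¬-cong-⇔ (prime⇔prime I ε F)
  prime⇔σ* I ε (F `∧ G)    = prime⇔σ* I ε F ×-⇔ prime⇔σ* I ε G
  prime⇔σ* I ε (F `∨ G)    = prime⇔σ* I ε F ⊎-⇔ prime⇔σ* I ε G
  prime⇔σ* I ε (F `⇒ G)    =
    mk⇔ (λ f → to (→-cong-⇔ (prime⇔σ* I ε F) (prime⇔σ* I ε G)) f , to (prime⇔prime I ε (F `⇒ G)) f)
        (λ (f , _) → from (→-cong-⇔ (prime⇔σ* I ε F) (prime⇔σ* I ε G)) f)
  prime⇔σ* I ε (`∀ s F)    = ∀-⇔ λ d → prime⇔σ* I (d ∷ ε) F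
  prime⇔σ* I ε (`∃ s F)    = ∃-⇔ λ d → prime⇔σ* I (d ∷ ε) F

  evals-con : ∀ rs → evals [] (map con rs) ≡ rs
  evals-con []       = refl
  evals-con (r ∷ rs) = cong (r ∷_) (evals-con rs)

  evals-vars : ∀ {Γ k} (ε : Env Γ) (zs : Vec (prog ∈ Γ) k) →
               evals ε (Vec.toList (Vec.map `_ zs)) ≡ Vec.toList (Vec.map (All.lookup ε) zs)
  evals-vars ε []       = refl
  evals-vars ε (z ∷ zs) = cong (_ ∷_) (evals-vars ε zs)

  ⊨𝒜⇔⊆ : ∀ I → I ⊨𝒜 ⇔ worldᴴ I ⊆ worldᵀ I
  ⊨𝒜⇔⊆ I =
    mk⇔ (λ f {(p , rs)} → subst (λ ss → I (plain p , ss) → I (primed p , ss)) (evals-con rs) (f (p , rs)))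
        (λ H⊆T (p , rs) → H⊆T)

  module _ {I : Interpretation} (H⊆T : worldᴴ I ⊆ worldᵀ I) where

    -- This is persistence on the classical side: atoms use `H⊆T`, negations are primed already, and
    -- an implication carries its primed copy as second conjunct.
    σ*⇒prime : ∀ {Γ} {ε : Env Γ} F → I ⊨[ ε ] σ* F → I ⊨[ ε ] prime F
    σ*⇒prime (atom p ts) = H⊆T
    σ*⇒prime (cmp c t u) = id
    σ*⇒prime `⊥          = id
    σ*⇒prime `⊤          = id
    σ*⇒prime (`¬ F)      = id
    σ*⇒prime (F `∧ G)    = Product.map (σ*⇒prime F) (σ*⇒prime G)
    σ*⇒prime (F `∨ G)    = Sum.map (σ*⇒prime F) (σ*⇒prime G)
    σ*⇒prime (F `⇒ G)    = proj₂
    σ*⇒prime (`∀ s F)    f d = σ*⇒prime F (f d)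
    σ*⇒prime (`∃ s F)    (d , f) = d , σ*⇒prime F f

  -- Environments for blocks of quantifiers

  extend : ∀ {Γ k} → Vec (Precomputed Const) k → Env Γ → Env (replicate k prog ++ Γ)
  extend []       ε = ε
  extend (d ∷ ds) ε = d ∷ extend ds ε

  -- The head of the context is bound innermost, so the recursion goes through the formula already
  -- quantified once, and the value of the head comes out last.
  ∃*-⇔ : ∀ {Γ} I (ε : Env Γ) k F → I ⊨[ ε ] σ* (`∃* (replicate k prog) F) ⇔
         (∃ λ (ds : Vec _ k) → I ⊨[ extend ds ε ] σ* F)
  ∃*-⇔ I ε zero    F = mk⇔ (λ f → [] , f) (λ { ([] , f) → f })
  ∃*-⇔ I ε (suc k) F =
    mk⇔ (λ f → let ds , d , g = to (∃*-⇔ I ε k (`∃ prog F)) f in d ∷ ds , g)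
        (λ { (d ∷ ds , g) → from (∃*-⇔ I ε k (`∃ prog F)) (ds , d , g) })

  ∀*-⇔ : ∀ {Γ} I (ε : Env Γ) k F → I ⊨[ ε ] σ* (`∀* (replicate k prog) F) ⇔
         (∀ (ds : Vec _ k) → I ⊨[ extend ds ε ] σ* F)
  ∀*-⇔ I ε zero    F = mk⇔ (λ { f [] → f }) (λ f → f [])
  ∀*-⇔ I ε (suc k) F =
    mk⇔ (λ { f (d ∷ ds) → to (∀*-⇔ I ε k (`∀ prog F)) f ds d })
        (λ f → from (∀*-⇔ I ε k (`∀ prog F)) (λ ds d → f (d ∷ ds)))

  lookup-weaken : ∀ {Γ k s} (ds : Vec _ k) (ε : Env Γ) (x : s ∈ Γ) →
                  All.lookup (extend ds ε) (weaken (replicate k prog) x) ≡ All.lookup ε x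
  lookup-weaken []       ε x = refl
  lookup-weaken (d ∷ ds) ε x = lookup-weaken ds ε x

  lookup-fresh : ∀ {Γ k} (ds : Vec _ k) (ε : Env Γ) →
                 Vec.map (All.lookup (extend ds ε)) (fresh k) ≡ ds
  lookup-fresh []                ε = refl
  lookup-fresh {k = suc k} (d ∷ ds) ε =
    cong (d ∷_) (trans (sym (Vec.map-∘ (All.lookup (d ∷ extend ds ε)) there (fresh k))) (lookup-fresh ds ε))

  eval-fresh : ∀ {Γ k} (ds : Vec _ k) (ε : Env Γ) →
               evals (extend ds ε) (Vec.toList (Vec.map `_ (fresh k))) ≡ Vec.toList ds
  eval-fresh ds ε = trans (evals-vars (extend ds ε) (fresh _)) (cong Vec.toList (lookup-fresh ds ε))

  -- The coercion of a variable to a program term depends on its sort, so both sides reduce only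
  -- after a split on `s`.
  eval-cong : ∀ {Γ Δ s} {ε : Env Γ} {δ : Env Δ} (x : s ∈ Γ) (y : s ∈ Δ) →
              All.lookup ε x ≡ All.lookup δ y → eval ε (` x) ≡ eval δ (` y)
  eval-cong {s = prog} x y e = e
  eval-cong {s = int}  x y e = cong num e

  -- Pointwise agreement, rather than equality of functions, suffices to match an assignment with
  -- the vector that tabulates it.
  Agree : ∀ {n Γ} → Env Γ → (Fin n → prog ∈ Γ) → (Fin n → Precomputed Const) → Set
  Agree ε ρ θ = ∀ x → All.lookup ε (ρ x) ≡ θ x

  Agree-weaken : ∀ {n Γ k} {ε : Env Γ} {ρ : Fin n → prog ∈ Γ} {θ} (ds : Vec _ k) → Agree ε ρ θ →
                 Agree (extend ds ε) (λ x → weaken (replicate k prog) (ρ x)) θ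
  Agree-weaken ds ρ≈θ x = trans (lookup-weaken ds _ _) (ρ≈θ x)

  -- Quantifier blocks range over vectors of fixed length, values of a tuple over lists; a list of
  -- values has the right length to be read as such a vector.
  fromTupValues : ∀ {n} (θ : Fin n → Precomputed Const) ts {rs} → tupValues (substTerms θ ts) rs →
                  ∃ λ (ds : Vec _ (length ts)) → Vec.toList ds ≡ rs
  fromTupValues θ []       {[]}     _        = [] , refl
  fromTupValues θ (t ∷ ts) {r ∷ rs} (_ , vs) =
    let ds , e = fromTupValues θ ts vs in r ∷ ds , cong (r ∷_) e

  -- The formulas `val` and the sets of values

  module _ {n : ℕ} (θ : Fin n → Precomputed Const) (I : Interpretation) where

    -- Formulas `val` contain no predicates, so the right-hand side does not mention `I`. That
    -- independence later allows passing between `I` and `collapse I`.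
    val-⇔ : ∀ {Γ s} (ε : Env Γ) (ρ : Fin n → prog ∈ Γ) → Agree ε ρ θ → (t : Term Const n) (z : s ∈ Γ) →
            I ⊨[ ε ] σ* (val ρ t z) ⇔ values (substTerm θ t) (eval ε (` z))
    vals-⇔ : ∀ {Γ} (ε : Env Γ) (ρ : Fin n → prog ∈ Γ) → Agree ε ρ θ →
             (ts : List (Term Const n)) (zs : Vec (prog ∈ Γ) (length ts)) →
             I ⊨[ ε ] σ* (vals ρ ts zs) ⇔
             tupValues (substTerms θ ts) (Vec.toList (Vec.map (All.lookup ε) zs))
    vals-fresh-⇔ : ∀ {Γ} (ε : Env Γ) (ρ : Fin n → prog ∈ Γ) → Agree ε ρ θ →
             (ts : List (Term Const n)) (ds : Vec _ (length ts)) →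
             I ⊨[ extend ds ε ] σ* (vals (λ x → weaken (replicate (length ts) prog) (ρ x)) ts (fresh _)) ⇔
             tupValues (substTerms θ ts) (Vec.toList ds)
    valPool-⇔ : ∀ {Γ s} (ε : Env Γ) (ρ : Fin n → prog ∈ Γ) → Agree ε ρ θ →
                (ts : List (Term Const n)) (z : s ∈ Γ) →
                I ⊨[ ε ] σ* (valPool ρ ts z) ⇔ anyValues (substTerms θ ts) (eval ε (` z))

    val-⇔ ε ρ ρ≈θ (num m)  z = sym-⇔
    val-⇔ ε ρ ρ≈θ (symb c) z = sym-⇔
    val-⇔ ε ρ ρ≈θ inf      z = sym-⇔
    val-⇔ ε ρ ρ≈θ sup      z = sym-⇔
    val-⇔ ε ρ ρ≈θ (var x)  z =
      mk⇔ (λ e → from (values-embed (θ x)) (trans (sym (ρ≈θ x)) (sym e)))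
          (λ v → trans (sym (to (values-embed (θ x)) v)) (sym (ρ≈θ x)))
    val-⇔ {Γ} ε ρ ρ≈θ (arith o t u) z =
      -- The quantifier of J is outermost, so witnesses arrive in the reverse of the order of the
      -- context; likewise in the clauses below.
      mk⇔ (λ (j , i , e , v , w) →
             i , j , to (t⇔ i j) v , to (u⇔ i j) w , trans (eval-cong z (weaken Δ z) refl) e)
          (λ (i , j , v , w , e) →
             j , i , trans (eval-cong (weaken Δ z) z refl) e , from (t⇔ i j) v , from (u⇔ i j) w)
      where
      Δ : Ctx
      Δ = int ∷ int ∷ []
      t⇔ = λ i j → val-⇔ (i ∷ j ∷ ε) (λ x → weaken Δ (ρ x)) ρ≈θ t (here refl)
      u⇔ = λ i j → val-⇔ (i ∷ j ∷ ε) (λ x → weaken Δ (ρ x)) ρ≈θ u (there (here refl))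
    val-⇔ {Γ} ε ρ ρ≈θ (quot t u) z =
      mk⇔ (λ (r , q , j , i , e , v , w , j≢0 , b , d) →
             let instance nz = ℤ.≢-nonZero (j≢0 ∘ cong num) in
             i , j , to (t⇔ i j q r) v , to (u⇔ i j q r) w , nz ,
             trans (eval-cong z (weaken Δ z) refl)
               (trans d (cong num (⌊/⌋-unique (num-injective e) (to remainder-⇔ b)))))
          (λ (i , j , v , w , nz , e) →
             let instance _ = nz
                 -- With the floor as quotient, the remainder is forced by the equation for I.
                 q = ⌊ i / j ⌋ ; r = i ℤ.- j ℤ.* q in
             r , q , j , i , cong num (dividend i j q) , from (t⇔ i j q r) v , from (u⇔ i j q r) w ,
             ℕ.≢-nonZero⁻¹ ℤ.∣ j ∣ ∘ cong ℤ.∣_∣ ∘ num-injective , from remainder-⇔ (⌊/⌋-remainder i j) ,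
             trans (eval-cong (weaken Δ z) z refl) e)
      where
      Δ : Ctx
      Δ = int ∷ int ∷ int ∷ int ∷ []
      t⇔ = λ i j q r → val-⇔ (i ∷ j ∷ q ∷ r ∷ ε) (λ x → weaken Δ (ρ x)) ρ≈θ t (here refl)
      u⇔ = λ i j q r → val-⇔ (i ∷ j ∷ q ∷ r ∷ ε) (λ x → weaken Δ (ρ x)) ρ≈θ u (there (here refl))
    val-⇔ {Γ} ε ρ ρ≈θ (rem t u) z =
      mk⇔ (λ (r , q , j , i , e , v , w , j≢0 , b , d) →
             let instance nz = ℤ.≢-nonZero (j≢0 ∘ cong num) in
             i , j , to (t⇔ i j q r) v , to (u⇔ i j q r) w , nz ,
             trans (eval-cong z (weaken Δ z) refl)
               (trans d (cong num (remainder-unique (num-injective e) (to remainder-⇔ b)))))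
          (λ (i , j , v , w , nz , e) →
             let instance _ = nz
                 q = ⌊ i / j ⌋ ; r = i ℤ.- j ℤ.* q in
             r , q , j , i , cong num (dividend i j q) , from (t⇔ i j q r) v , from (u⇔ i j q r) w ,
             ℕ.≢-nonZero⁻¹ ℤ.∣ j ∣ ∘ cong ℤ.∣_∣ ∘ num-injective , from remainder-⇔ (⌊/⌋-remainder i j) ,
             trans (eval-cong (weaken Δ z) z refl) e)
      where
      Δ : Ctx
      Δ = int ∷ int ∷ int ∷ int ∷ []
      t⇔ = λ i j q r → val-⇔ (i ∷ j ∷ q ∷ r ∷ ε) (λ x → weaken Δ (ρ x)) ρ≈θ t (here refl)
      u⇔ = λ i j q r → val-⇔ (i ∷ j ∷ q ∷ r ∷ ε) (λ x → weaken Δ (ρ x)) ρ≈θ u (there (here refl))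
    val-⇔ {Γ} ε ρ ρ≈θ (interval t u) z =
      mk⇔ (λ (k , j , i , v , w , i≤k , k≤j , e) →
             i , j , k , to (t⇔ i j k) v , to (u⇔ i j k) w , to (num-≤ i k) i≤k , to (num-≤ k j) k≤j ,
             trans (eval-cong z (weaken Δ z) refl) e)
          (λ (i , j , k , v , w , i≤k , k≤j , e) →
             k , j , i , from (t⇔ i j k) v , from (u⇔ i j k) w , from (num-≤ i k) i≤k , from (num-≤ k j) k≤j ,
             trans (eval-cong (weaken Δ z) z refl) e)
      where
      Δ : Ctx
      Δ = int ∷ int ∷ int ∷ []
      t⇔ = λ i j k → val-⇔ (i ∷ j ∷ k ∷ ε) (λ x → weaken Δ (ρ x)) ρ≈θ t (here refl)
      u⇔ = λ i j k → val-⇔ (i ∷ j ∷ k ∷ ε) (λ x → weaken Δ (ρ x)) ρ≈θ u (there (here refl))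
    val-⇔ {Γ} ε ρ ρ≈θ (tuple ts) z =
      mk⇔ (λ f → let ds , e , v = to (∃*-⇔ I ε (length ts) F) f in
             Vec.toList ds , to (vals-fresh-⇔ ε ρ ρ≈θ ts ds) v ,
             trans (eval-cong z (weaken Δ z) (sym (lookup-weaken ds ε z)))
               (trans e (cong tup (eval-fresh ds ε))))
          (λ (_ , v , e) → from (∃*-⇔ I ε (length ts) F) (holds v e (fromTupValues θ ts v)))
      where
      Δ = replicate (length ts) prog
      F : Formula Const Const (Δ ++ Γ)
      F = cmp eq (` weaken Δ z) (tup (Vec.toList (Vec.map `_ (fresh (length ts)))))
          `∧ vals (λ x → weaken Δ (ρ x)) ts (fresh (length ts))
      -- The list `rs` is kept arbitrary so that matching on `refl` can replace it by the components
      -- of `ds`.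
      holds : ∀ {rs} → tupValues (substTerms θ ts) rs → eval ε (` z) ≡ tup rs →
              ∃ (λ (ds : Vec _ (length ts)) → Vec.toList ds ≡ rs) →
              ∃ λ (ds : Vec _ (length ts)) → I ⊨[ extend ds ε ] σ* F
      holds v e (ds , refl) =
        ds , trans (eval-cong (weaken Δ z) z (lookup-weaken ds ε z))
               (trans e (cong tup (sym (eval-fresh ds ε)))) ,
        from (vals-fresh-⇔ ε ρ ρ≈θ ts ds) v
    val-⇔ ε ρ ρ≈θ (pool (t ∷ ts)) z = val-⇔ ε ρ ρ≈θ t z ⊎-⇔ valPool-⇔ ε ρ ρ≈θ ts z

    vals-⇔ ε ρ ρ≈θ []       []       = ⇔.refl
    vals-⇔ ε ρ ρ≈θ (t ∷ ts) (z ∷ zs) = val-⇔ ε ρ ρ≈θ t z ×-⇔ vals-⇔ ε ρ ρ≈θ ts zs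

    vals-fresh-⇔ ε ρ ρ≈θ ts ds =
      subst (λ es → I ⊨[ extend ds ε ] σ* (vals (λ x → weaken (replicate (length ts) prog) (ρ x)) ts (fresh _)) ⇔
                    tupValues (substTerms θ ts) (Vec.toList es)) (lookup-fresh ds ε)
        (vals-⇔ (extend ds ε) _ (Agree-weaken ds ρ≈θ) ts (fresh _))

    valPool-⇔ ε ρ ρ≈θ []       z = ⇔.refl
    valPool-⇔ ε ρ ρ≈θ (t ∷ ts) z = val-⇔ ε ρ ρ≈θ t z ⊎-⇔ valPool-⇔ ε ρ ρ≈θ ts z

  interpretation : Pred 𝒫 0ℓ → Pred 𝒫 0ℓ → Interpretation
  interpretation H T (plain p  , rs) = H (p , rs)
  interpretation H T (primed p , rs) = T (p , rs)

  collapse-⊆ : ∀ I → worldᴴ (collapse I) ⊆ worldᵀ (collapse I)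
  collapse-⊆ I = id

  -- Bodies, heads and rules

  allValues someValues : (List (Precomputed Const) → Infinitary 𝒫) → List (Term Const 0) → Infinitary 𝒫
  allValues  G ts = ⋀ (∃ (tupValues ts)) λ (rs , _) → G rs
  someValues G ts = ⋁ (∃ (tupValues ts)) λ (rs , _) → G rs

  module _ (I : Interpretation) where

    infix 3 ⊨′_
    ⊨′_ : Infinitary 𝒫 → Set
    ⊨′ F = ⟨ worldᴴ I , worldᵀ I ⟩⊨ F

    ⋁-⇔ : ∀ {A B : Set} {Γ} {ε : Env Γ} {f : A → Formula Const Const Γ} {g : A → B} (F : B → Infinitary 𝒫) →
          (∀ x → I ⊨[ ε ] σ* (f x) ⇔ (⊨′ F (g x))) →
          ∀ xs → I ⊨[ ε ] σ* (`⋁ (map f xs)) ⇔ (⊨′ ⋁ₗ (map g xs) F)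
    ⋁-⇔ F f⇔g []       = mk⇔ (λ ()) (λ ())
    ⋁-⇔ F f⇔g (x ∷ xs) =
      mk⇔ (λ { (inj₁ v) → zero , to (f⇔g x) v
             ; (inj₂ w) → let i , v = to (⋁-⇔ F f⇔g xs) w in suc i , v })
          (λ { (zero  , v) → inj₁ (from (f⇔g x) v)
             ; (suc i , v) → inj₂ (from (⋁-⇔ F f⇔g xs) (i , v)) })

    ⋀-⇔ : ∀ {A B : Set} {Γ} {ε : Env Γ} {f : A → Formula Const Const Γ} {g : A → B} (F : B → Infinitary 𝒫) →
          (∀ x → I ⊨[ ε ] σ* (f x) ⇔ (⊨′ F (g x))) →
          ∀ xs → I ⊨[ ε ] σ* (`⋀ (map f xs)) ⇔ (⊨′ ⋀ₗ (map g xs) F)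
    ⋀-⇔ F f⇔g []       = mk⇔ (λ _ ()) (λ _ → tt)
    ⋀-⇔ F f⇔g (x ∷ xs) =
      mk⇔ (λ { (v , vs) zero → to (f⇔g x) v ; (v , vs) (suc i) → to (⋀-⇔ F f⇔g xs) vs i })
          (λ vs → from (f⇔g x) (vs zero) , from (⋀-⇔ F f⇔g xs) (vs ∘ suc))

    signed-⇔ : ∀ {Γ} {ε : Env Γ} ℓ p ts {rs} → evals ε ts ≡ rs →
               I ⊨[ ε ] σ* (signed ℓ (atom p ts)) ⇔ (⊨′ signed′ ℓ (atom (p , rs)))
    signed-⇔ pos    p ts refl = ⇔.refl
    signed-⇔ not    p ts refl = ⇔.refl
    signed-⇔ notnot p ts refl = ⇔.refl

    module _ {n : ℕ} {Γ : Ctx} (θ : Fin n → Precomputed Const)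
             (ε : Env Γ) (ρ : Fin n → prog ∈ Γ) (ρ≈θ : Agree ε ρ θ) where

      bodyMember-⇔ : ∀ ts {G : Formula Const Const (replicate (length ts) prog ++ Γ)}
                     (G′ : List (Precomputed Const) → Infinitary 𝒫) →
                     (∀ ds → I ⊨[ extend ds ε ] σ* G ⇔ (⊨′ G′ (Vec.toList ds))) →
                     I ⊨[ ε ] σ* (`∃* (replicate (length ts) prog)
                       (vals (λ x → weaken (replicate (length ts) prog) (ρ x)) ts (fresh _) `∧ G)) ⇔
                     (⊨′ someValues G′ (substTerms θ ts))
      bodyMember-⇔ ts {G} G′ G⇔G′ = ⇔.trans (∃*-⇔ I ε (length ts) (V `∧ G))
        (mk⇔ (λ (ds , v , g) → (Vec.toList ds , to (vals⇔ ds) v) , to (G⇔G′ ds) g)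
             (λ ((rs , v) , g) → let ds , e = fromTupValues θ ts v in
                ds , from (vals⇔ ds) (subst (tupValues _) (sym e) v) ,
                from (G⇔G′ ds) (subst (λ rs → ⊨′ G′ rs) (sym e) g)))
        where
        V = vals (λ x → weaken (replicate (length ts) prog) (ρ x)) ts (fresh _)
        vals⇔ = vals-fresh-⇔ θ I ε ρ ρ≈θ ts

      τᴮ-⇔ : (B : BodyExpr Const n) → I ⊨[ ε ] σ* (τᴮ ρ B) ⇔ (⊨′ bodyFormula (substBody θ B))
      τᴮ-⇔ (lit ℓ (p ⟨ ts ∷ tss ⟩)) =
        ⋁-⇔ (someValues G′) (λ ts → bodyMember-⇔ ts G′ λ ds → signed-⇔ ℓ p _ (eval-fresh ds ε)) (ts ∷ tss)
        where
        G′ = λ rs → signed′ ℓ (atom (p , rs))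
      τᴮ-⇔ (cmp c t u) =
        -- The final `λ ()` inhabits the empty conjunction `⊤′` inside `⌜_⌝`.
        mk⇔ (λ (d₂ , d₁ , v , w , e) → (d₁ , d₂ , to (t⇔ d₁ d₂) v , to (u⇔ d₁ d₂) w , e) , λ ())
            (λ ((d₁ , d₂ , v , w , e) , _) → d₂ , d₁ , from (t⇔ d₁ d₂) v , from (u⇔ d₁ d₂) w , e)
        where
        t⇔ = λ d₁ d₂ → val-⇔ θ I (d₁ ∷ d₂ ∷ ε) (λ x → there (there (ρ x))) ρ≈θ t (here refl)
        u⇔ = λ d₁ d₂ → val-⇔ θ I (d₁ ∷ d₂ ∷ ε) (λ x → there (there (ρ x))) ρ≈θ u (there (here refl))

      module _ (H⊆T : worldᴴ I ⊆ worldᵀ I) where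

        -- The second conjunct of σ* (F ⇒ G) costs nothing here: F contains no
        -- atoms, so F′ gives F, and σ* G gives G′ by persistence.
        headMember-⇔ : ∀ ts {G : Formula Const Const (replicate (length ts) prog ++ Γ)}
                       (G′ : List (Precomputed Const) → Infinitary 𝒫) →
                       (∀ ds → I ⊨[ extend ds ε ] σ* G ⇔ (⊨′ G′ (Vec.toList ds))) →
                       I ⊨[ ε ] σ* (`∀* (replicate (length ts) prog)
                         (vals (λ x → weaken (replicate (length ts) prog) (ρ x)) ts (fresh _) `⇒ G)) ⇔
                       (⊨′ allValues G′ (substTerms θ ts))
        headMember-⇔ ts {G} G′ G⇔G′ = ⇔.trans (∀*-⇔ I ε (length ts) (V `⇒ G))
          (mk⇔ (λ f (rs , v) → let ds , e = fromTupValues θ ts v in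
                  subst (λ rs → ⊨′ G′ rs) e
                    (to (G⇔G′ ds) (proj₁ (f ds) (from (vals⇔ I ds) (subst (tupValues _) (sym e) v)))))
               (λ g ds → let g′ = λ v → from (G⇔G′ ds) (g (Vec.toList ds , v)) in
                  (λ v → g′ (to (vals⇔ I ds) v)) ,
                  (λ v → σ*⇒prime H⊆T G
                           (g′ (to (vals⇔ (collapse I) ds) (to (prime⇔σ* I (extend ds ε) V) v))))))
          where
          V = vals (λ x → weaken (replicate (length ts) prog) (ρ x)) ts (fresh _)
          vals⇔ = λ J ds → vals-fresh-⇔ θ J ε ρ ρ≈θ ts ds

        τᴴ-⇔ : (A : Head Const n) → I ⊨[ ε ] σ* (τᴴ ρ A) ⇔ (⊨′ headFormula (substHead θ A))
        τᴴ-⇔ (basic (p ⟨ ts ∷ tss ⟩)) =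
          ⋀-⇔ (allValues G′) (λ ts → headMember-⇔ ts G′ λ ds → signed-⇔ pos p _ (eval-fresh ds ε)) (ts ∷ tss)
          where
          G′ = λ rs → atom (p , rs)
        τᴴ-⇔ (choice (p ⟨ ts ∷ tss ⟩)) =
          ⋀-⇔ (allValues G′) (λ ts → headMember-⇔ ts G′ λ ds →
            mk⇔ (λ { (inj₁ v) → true  , to (signed-⇔ pos p _ (eval-fresh ds ε)) v
                   ; (inj₂ v) → false , to (signed-⇔ not p _ (eval-fresh ds ε)) v })
                (λ { (true  , v) → inj₁ (from (signed-⇔ pos p _ (eval-fresh ds ε)) v)
                   ; (false , v) → inj₂ (from (signed-⇔ not p _ (eval-fresh ds ε)) v) }))
            (ts ∷ tss)
          where
          G′ = λ rs → atom (p , rs) ∨′ (¬′ atom (p , rs))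
        τᴴ-⇔ empty = mk⇔ (λ ()) (λ ())

  module _ {I : Interpretation} (H⊆T : worldᴴ I ⊆ worldᵀ I) where

    -- The first conjunct of `σ*` of the implication is read at `I`. The primed conjunct is read at
    -- `collapse I`, both of whose worlds are `worldᵀ I`, as the second half of here-and-there
    -- implication demands.
    instance-⇔ : (R : Rule Const) → let open Rule R in
      (θ : Fin vars → Precomputed Const) (ε : Env (replicate vars prog ++ []))
      (ρ : Fin vars → prog ∈ replicate vars prog ++ []) → Agree ε ρ θ →
      I ⊨[ ε ] σ* (`⋀ (map (τᴮ ρ) body) `⇒ τᴴ ρ head) ⇔ (⟨ worldᴴ I , worldᵀ I ⟩⊨ instanceFormula R θ)
    instance-⇔ R θ ε ρ ρ≈θ =
      →-cong-⇔ (body⇔ I) (τᴴ-⇔ I θ ε ρ ρ≈θ H⊆T head) ×-⇔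
      →-cong-⇔ (⇔.trans (prime⇔σ* I ε (`⋀ (map (τᴮ ρ) body))) (body⇔ (collapse I)))
               (⇔.trans (prime⇔σ* I ε (τᴴ ρ head)) (τᴴ-⇔ (collapse I) θ ε ρ ρ≈θ (collapse-⊆ I) head))
      where
      open Rule R
      body⇔ = λ J → ⋀-⇔ J bodyFormula (τᴮ-⇔ J θ ε ρ ρ≈θ) body

    τ*ᴿ-⇔ : (R : Rule Const) → I ⊨ σ* (τ*ᴿ R) ⇔ (∀ θ → ⟨ worldᴴ I , worldᵀ I ⟩⊨ instanceFormula R θ)
    τ*ᴿ-⇔ R = ⇔.trans (∀*-⇔ I [] vars _)
      (mk⇔ (λ f θ → let ds = Vec.tabulate θ in
              to (instance-⇔ R θ (extend ds []) _
                   (λ x → trans (lookup-var ds x) (Vec.lookup∘tabulate θ x))) (f ds))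
           (λ f ds → from (instance-⇔ R (Vec.lookup ds) (extend ds []) _ (lookup-var ds)) (f (Vec.lookup ds))))
      where
      open Rule R
      lookup-var : (ds : Vec _ vars) → Agree (extend ds []) (Vec.lookup (fresh vars)) (Vec.lookup ds)
      lookup-var ds x = trans (sym (Vec.lookup-map x (All.lookup (extend ds [])) (fresh vars)))
                              (cong (λ es → Vec.lookup es x) (lookup-fresh ds []))

    τ*-⇔ : (Π : Program Const) → I ⊨ˢ map σ* (τ* Π) ⇔ (⟨ worldᴴ I , worldᵀ I ⟩⊨ᵗ τ Π)
    τ*-⇔ Π = mk⇔ (λ f (R , R∈Π , θ) → to (τ*ᴿ-⇔ R) (All.lookup (All.map⁻ (All.map⁻ f)) R∈Π) θ)
                 (λ f → All.map⁺ (All.map⁺ (All.tabulate λ {R} R∈Π → from (τ*ᴿ-⇔ R) λ θ → f (R , R∈Π , θ))))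

-- Persistence and locality of here-and-there satisfaction

module _ {P : Set} where

  persistence : {H T : Pred P 0ℓ} → H ⊆ T → (F : Infinitary P) → (⟨ H , T ⟩⊨ F) → (⟨ T , T ⟩⊨ F)
  persistence H⊆T (atom p)  = H⊆T
  persistence H⊆T (⋀ A F)   = λ f a → persistence H⊆T (F a) (f a)
  persistence H⊆T (⋁ A F)   = λ (a , f) → a , persistence H⊆T (F a) f
  persistence H⊆T (¬′ F)    = id
  persistence H⊆T (F ⇒′ G)  = λ (_ , f) → f , f

  Within : Pred P 0ℓ → Infinitary P → Set
  Within Q (atom p)  = Q p
  Within Q (⋀ A F)   = ∀ a → Within Q (F a)
  Within Q (⋁ A F)   = ∀ a → Within Q (F a)
  Within Q (¬′ F)    = Within Q F
  Within Q (F ⇒′ G)  = Within Q F × Within Q G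

  AgreeOn : (Q H H′ : Pred P 0ℓ) → Set
  AgreeOn Q H H′ = ∀ a → Q a → H a ⇔ H′ a

  -- Negation and the second half of an implication look at the there-world only, hence the calls
  -- with `T≈` in both places.
  locality : ∀ {Q H T H′ T′ : Pred P 0ℓ} → AgreeOn Q H H′ → AgreeOn Q T T′ →
             ∀ F → Within Q F → (⟨ H , T ⟩⊨ F) ⇔ (⟨ H′ , T′ ⟩⊨ F)
  locality H≈ T≈ (atom p) w       = H≈ p w
  locality H≈ T≈ (⋀ A F)  w       = ∀-⇔ λ a → locality H≈ T≈ (F a) (w a)
  locality H≈ T≈ (⋁ A F)  w       = ∃-⇔ λ a → locality H≈ T≈ (F a) (w a)
  locality H≈ T≈ (¬′ F)   w       = ¬-cong-⇔ (locality T≈ T≈ F w)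
  locality H≈ T≈ (F ⇒′ G) (w , x) =
    →-cong-⇔ (locality H≈ T≈ F w) (locality H≈ T≈ G x) ×-⇔
    →-cong-⇔ (locality T≈ T≈ F w) (locality T≈ T≈ G x)

lookup-map-∈ : {A B : Set} (f : A → B) (xs : List A) (i : Fin (length (map f xs))) →
               ∃ λ x → x ∈ xs × lookup (map f xs) i ≡ f x
lookup-map-∈ f xs i = ∈.∈-map⁻ f (∈.∈-lookup i)

-- Predicates occurring in a program

module _ {C : Set} where

  -- A predicate is a symbol with an arity, and the members of one pool may differ in arity.
  atomPredicates : ∀ {n} → Atom C n → List (C × ℕ)
  atomPredicates (p ⟨ tss ⟩) = map (λ ts → p , length ts) (toList tss)

  bodyPredicates : ∀ {n} → BodyExpr C n → List (C × ℕ)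
  bodyPredicates (lit _ A)   = atomPredicates A
  bodyPredicates (cmp _ _ _) = []

  headPredicates : ∀ {n} → Head C n → List (C × ℕ)
  headPredicates (basic A)  = atomPredicates A
  headPredicates (choice A) = atomPredicates A
  headPredicates empty      = []

  rulePredicates : Rule C → List (C × ℕ)
  rulePredicates R = headPredicates head ++ concatMap bodyPredicates body
    where open Rule R

  predicates : Program C → List (C × ℕ)
  predicates = concatMap rulePredicates

module Reduction (𝓢 : Signature) where

  open Semantics 𝓢

  τ-++ : ∀ {H T} Π₁ Π₂ → (⟨ H , T ⟩⊨ᵗ τ (Π₁ ++ Π₂)) ⇔ ((⟨ H , T ⟩⊨ᵗ τ Π₁) × (⟨ H , T ⟩⊨ᵗ τ Π₂))
  τ-++ Π₁ Π₂ =
    mk⇔ (λ f → (λ (R , R∈ , θ) → f (R , ∈.∈-++⁺ˡ R∈ , θ)) , (λ (R , R∈ , θ) → f (R , ∈.∈-++⁺ʳ Π₁ R∈ , θ)))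
        (λ (f , g) (R , R∈ , θ) → [ (λ R∈ → f (R , R∈ , θ)) , (λ R∈ → g (R , R∈ , θ)) ] (∈.∈-++⁻ Π₁ R∈))

  persistenceᵗ : ∀ {H T} → H ⊆ T → ∀ Π → (⟨ H , T ⟩⊨ᵗ τ Π) → (⟨ T , T ⟩⊨ᵗ τ Π)
  persistenceᵗ H⊆T Π f a = persistence H⊆T (proj₂ (τ Π) a) (f a)

  module _ (S : List (Const × ℕ)) where

    OverS : Pred 𝒫 0ℓ
    OverS (p , rs) = (p , length rs) ∈ S

    -- Neither substitution nor evaluation changes the number of arguments, so the ground atoms of
    -- an instance belong to predicates already visible in the rule.
    within-member : ∀ {n} (θ : Fin n → Precomputed Const) p (tss : List (List (Term Const n))) →
                    map (λ ts → p , length ts) tss ⊆ₗ S →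
                    ∀ i rs → tupValues (lookup (map (substTerms θ) tss) i) rs → OverS (p , rs)
    within-member θ p tss ⊆S i rs v =
      let ts , ts∈ , e = lookup-map-∈ (substTerms θ) tss i in
      subst (λ k → (p , k) ∈ S) (sym (substTerms-length θ ts (subst (λ us → tupValues us rs) e v)))
        (⊆S (∈.∈-map⁺ _ ts∈))

    within-body : ∀ {n} (θ : Fin n → Precomputed Const) B → bodyPredicates B ⊆ₗ S →
                  Within OverS (bodyFormula (substBody θ B))
    within-body θ (lit pos    (p ⟨ ts ∷ tss ⟩)) ⊆S i (rs , v) = within-member θ p (ts ∷ tss) ⊆S i rs v
    within-body θ (lit not    (p ⟨ ts ∷ tss ⟩)) ⊆S i (rs , v) = within-member θ p (ts ∷ tss) ⊆S i rs v
    within-body θ (lit notnot (p ⟨ ts ∷ tss ⟩)) ⊆S i (rs , v) = within-member θ p (ts ∷ tss) ⊆S i rs v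
    within-body θ (cmp c t u) ⊆S _ ()

    within-head : ∀ {n} (θ : Fin n → Precomputed Const) A → headPredicates A ⊆ₗ S →
                  Within OverS (headFormula (substHead θ A))
    within-head θ (basic  (p ⟨ ts ∷ tss ⟩)) ⊆S i (rs , v) = within-member θ p (ts ∷ tss) ⊆S i rs v
    within-head θ (choice (p ⟨ ts ∷ tss ⟩)) ⊆S i (rs , v) =
      λ { true → within-member θ p (ts ∷ tss) ⊆S i rs v ; false → within-member θ p (ts ∷ tss) ⊆S i rs v }
    within-head θ empty ⊆S ()

    within-instance : ∀ R θ → rulePredicates R ⊆ₗ S → Within OverS (instanceFormula R θ)
    within-instance R θ ⊆S =
      (λ i → let B , B∈ , e = lookup-map-∈ (substBody θ) body i in
         subst (Within OverS ∘ bodyFormula) (sym e)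
           (within-body θ B λ x∈ → ⊆S (∈.∈-++⁺ʳ (headPredicates head) (∈.∈-concatMap⁺ bodyPredicates (lose B∈ x∈))))) ,
      within-head θ head (⊆S ∘ ∈.∈-++⁺ˡ)
      where open Rule R

    localityᵗ : ∀ {H T H′ T′} → AgreeOn OverS H H′ → AgreeOn OverS T T′ → ∀ Π → predicates Π ⊆ₗ S →
                (⟨ H , T ⟩⊨ᵗ τ Π) ⇔ (⟨ H′ , T′ ⟩⊨ᵗ τ Π)
    localityᵗ H≈ T≈ Π ⊆S = ∀-⇔ λ (R , R∈ , θ) →
      locality H≈ T≈ (instanceFormula R θ)
        (within-instance R θ λ x∈ → ⊆S (∈.∈-concatMap⁺ rulePredicates (lose R∈ x∈)))

    -- The context program and its answer sets

    module Gadget (h : Const) (fresh-h : h ∉ map proj₁ S) where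

      -- The predicate symbol becomes the first argument, so one fresh constant serves all
      -- predicates, and no mark equals `flag`, which has no arguments.
      mark : 𝒫 → 𝒫
      mark (p , rs) = h , symb p ∷ rs

      flag : 𝒫
      flag = h , []

      vars : ∀ k → List (Term Const k)
      vars k = tabulate var

      -- Argument tuples in the context program have exactly one value, so the disjunctions and
      -- conjunctions over values shrink to a single atom.
      Denotes : ∀ {n} → (Fin n → Precomputed Const) → List (Term Const n) → List (Precomputed Const) → Set
      Denotes θ ts rs = ∀ {rs′} → tupValues (substTerms θ ts) rs′ ⇔ rs ≡ rs′

      vars-denote : ∀ {k} (θ : Fin k → Precomputed Const) {rs} → tabulate θ ≡ rs → Denotes θ (vars k) rs
      vars-denote θ refl {rs′} =
        subst (λ ts → tupValues ts rs′ ⇔ tabulate θ ≡ rs′) (sym (embedded id)) (tupValues-embeds (tabulate θ))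
        where
        embedded : ∀ {m} (f : Fin m → Fin _) → substTerms θ (tabulate (var ∘ f)) ≡ embeds (tabulate (θ ∘ f))
        embedded {zero}  f = refl
        embedded {suc m} f = cong (_ ∷_) (embedded (f ∘ suc))

      markedVars-denote : ∀ {k p} (θ : Fin k → Precomputed Const) {rs} → tabulate θ ≡ rs →
                          Denotes θ (symb p ∷ vars k) (symb p ∷ rs)
      markedVars-denote θ e {[]}      = mk⇔ (λ ()) (λ ())
      markedVars-denote θ e {r ∷ rs′} =
        mk⇔ (λ (e₁ , v) → cong₂ _∷_ e₁ (to (vars-denote θ e) v))
            (λ { refl → refl , from (vars-denote θ e) refl })

      none-denotes : ∀ {k} (θ : Fin k → Precomputed Const) → Denotes θ [] []
      none-denotes θ {[]}    = mk⇔ (λ _ → refl) (λ _ → tt)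
      none-denotes θ {_ ∷ _} = mk⇔ (λ ()) (λ ())

      module _ (H T : Pred 𝒫 0ℓ) {n : ℕ} {θ : Fin n → Precomputed Const} where

        lit-⇔ : ∀ {p rs} ℓ ts → Denotes θ ts rs →
                (⟨ H , T ⟩⊨ bodyFormula (substBody θ (lit ℓ (p ⟨ ts ∷ [] ⟩)))) ⇔ (⟨ H , T ⟩⊨ signed′ ℓ (atom (p , rs)))
        lit-⇔ {p} ℓ ts d =
          mk⇔ (λ { (zero , (_ , v) , s) → subst (λ rs → ⟨ H , T ⟩⊨ signed′ ℓ (atom (p , rs))) (sym (to d v)) s })
              (λ s → zero , (_ , from d refl) , s)

        basic-⇔ : ∀ {p rs} ts → Denotes θ ts rs →
                  (⟨ H , T ⟩⊨ headFormula (substHead θ (basic (p ⟨ ts ∷ [] ⟩)))) ⇔ H (p , rs)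
        basic-⇔ {p} ts d =
          mk⇔ (λ f → f zero (_ , from d refl))
              (λ { x zero (_ , v) → subst (λ rs → H (p , rs)) (to d v) x })

        choice-⇔ : ∀ {p rs} ts → Denotes θ ts rs →
                   (⟨ H , T ⟩⊨ headFormula (substHead θ (choice (p ⟨ ts ∷ [] ⟩)))) ⇔ (H (p , rs) ⊎ ¬ T (p , rs))
        choice-⇔ {p} ts d =
          mk⇔ (λ f → ∨-to (f zero (_ , from d refl)))
              (λ { x zero (_ , v) → subst (λ rs → ⟨ H , T ⟩⊨ atom (p , rs) ∨′ (¬′ atom (p , rs))) (to d v) (∨-from x) })
          where
          ∨-to : ∀ {a} → (⟨ H , T ⟩⊨ atom a ∨′ (¬′ atom a)) → H a ⊎ ¬ T a
          ∨-to (true  , x) = inj₁ x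
          ∨-to (false , x) = inj₂ x
          ∨-from : ∀ {a} → H a ⊎ ¬ T a → ⟨ H , T ⟩⊨ atom a ∨′ (¬′ atom a)
          ∨-from (inj₁ x) = true  , x
          ∨-from (inj₂ x) = false , x

        body₁-⇔ : ∀ B {P : Set} → (⟨ H , T ⟩⊨ bodyFormula (substBody θ B)) ⇔ P →
                  (⟨ H , T ⟩⊨ ⋀ₗ (map (substBody θ) (B ∷ [])) bodyFormula) ⇔ P
        body₁-⇔ B B⇔P = mk⇔ (λ f → to B⇔P (f zero)) (λ { x zero → from B⇔P x })

        body₂-⇔ : ∀ A B {P Q : Set} → (⟨ H , T ⟩⊨ bodyFormula (substBody θ A)) ⇔ P →
                  (⟨ H , T ⟩⊨ bodyFormula (substBody θ B)) ⇔ Q →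
                  (⟨ H , T ⟩⊨ ⋀ₗ (map (substBody θ) (A ∷ B ∷ [])) bodyFormula) ⇔ (P × Q)
        body₂-⇔ A B A⇔P B⇔Q =
          mk⇔ (λ f → to A⇔P (f zero) , to B⇔Q (f (suc zero)))
              (λ { (x , y) zero → from A⇔P x ; (x , y) (suc zero) → from B⇔Q y })

      plainAtom markedAtom : ∀ {k} → Const → Atom Const k
      plainAtom  p = p ⟨ vars _ ∷ [] ⟩
      markedAtom p = h ⟨ (symb p ∷ vars _) ∷ [] ⟩

      flagAtom : ∀ k → Atom Const k
      flagAtom _ = h ⟨ [] ∷ [] ⟩

      chooseMark useMark raiseFlag saturate : Const × ℕ → Rule Const
      chooseMark (p , k) = record { vars = k ; head = choice (markedAtom p) ; body = [] }
      useMark    (p , k) = record { vars = k ; head = basic (plainAtom p)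
                                  ; body = lit pos (markedAtom p) ∷ [] }
      raiseFlag  (p , k) = record { vars = k ; head = basic (flagAtom k)
                                  ; body = lit pos (plainAtom p) ∷ lit not (markedAtom p) ∷ [] }
      saturate   (p , k) = record { vars = k ; head = basic (plainAtom p)
                                  ; body = lit pos (flagAtom k) ∷ lit notnot (plainAtom p) ∷ [] }

      gadgetRules : Const × ℕ → Program Const
      gadgetRules a = chooseMark a ∷ useMark a ∷ raiseFlag a ∷ saturate a ∷ []

      gadget : Program Const
      gadget = concatMap gadgetRules S

      -- These are the here-halves of the four rules at the atom `a`; the there-halves are
      -- `Closed T T a`.
      record Closed (H T : Pred 𝒫 0ℓ) (a : 𝒫) : Set where
        field
          marks     : H (mark a) ⊎ ¬ T (mark a)
          marked    : H (mark a) → H a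
          flagged   : H a × ¬ T (mark a) → H flag
          saturated : H flag × ¬ ¬ T a → H a

      module _ {H T : Pred 𝒫 0ℓ} where

        module _ {p : Const} {k : ℕ} (θ : Fin k → Precomputed Const)
                 {rs : List (Precomputed Const)} (e : tabulate θ ≡ rs) where

          chooseMark-⇔ : (⟨ H , T ⟩⊨ instanceFormula (chooseMark (p , k)) θ) ⇔
            ((⊤ → H (mark (p , rs)) ⊎ ¬ T (mark (p , rs))) × (⊤ → T (mark (p , rs)) ⊎ ¬ T (mark (p , rs))))
          chooseMark-⇔ =
            -- The antecedent of a rule without body is an empty conjunction, replaced here by `⊤`.
            →-cong-⇔ (mk⇔ _ (λ _ ())) (choice-⇔ H T (symb p ∷ vars k) (markedVars-denote θ e)) ×-⇔
            →-cong-⇔ (mk⇔ _ (λ _ ())) (choice-⇔ T T (symb p ∷ vars k) (markedVars-denote θ e))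

          useMark-⇔ : (⟨ H , T ⟩⊨ instanceFormula (useMark (p , k)) θ) ⇔
            ((H (mark (p , rs)) → H (p , rs)) × (T (mark (p , rs)) → T (p , rs)))
          useMark-⇔ = →-cong-⇔ (body H) (basic-⇔ H T (vars k) (vars-denote θ e)) ×-⇔
                      →-cong-⇔ (body T) (basic-⇔ T T (vars k) (vars-denote θ e))
            where
            body = λ J → body₁-⇔ J T {θ = θ} (lit pos (markedAtom p))
                           (lit-⇔ J T pos (symb p ∷ vars k) (markedVars-denote θ e))

          raiseFlag-⇔ : (⟨ H , T ⟩⊨ instanceFormula (raiseFlag (p , k)) θ) ⇔
            ((H (p , rs) × ¬ T (mark (p , rs)) → H flag) × (T (p , rs) × ¬ T (mark (p , rs)) → T flag))
          raiseFlag-⇔ = →-cong-⇔ (body H) (basic-⇔ H T {θ = θ} [] (none-denotes θ)) ×-⇔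
                        →-cong-⇔ (body T) (basic-⇔ T T {θ = θ} [] (none-denotes θ))
            where
            body = λ J → body₂-⇔ J T {θ = θ} (lit pos (plainAtom p)) (lit not (markedAtom p))
                           (lit-⇔ J T pos (vars k) (vars-denote θ e))
                           (lit-⇔ J T not (symb p ∷ vars k) (markedVars-denote θ e))

          saturate-⇔ : (⟨ H , T ⟩⊨ instanceFormula (saturate (p , k)) θ) ⇔
            ((H flag × ¬ ¬ T (p , rs) → H (p , rs)) × (T flag × ¬ ¬ T (p , rs) → T (p , rs)))
          saturate-⇔ = →-cong-⇔ (body H) (basic-⇔ H T (vars k) (vars-denote θ e)) ×-⇔
                       →-cong-⇔ (body T) (basic-⇔ T T (vars k) (vars-denote θ e))
            where
            body = λ J → body₂-⇔ J T {θ = θ} (lit pos (flagAtom k)) (lit notnot (plainAtom p))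
                           (lit-⇔ J T {θ = θ} pos [] (none-denotes θ))
                           (lit-⇔ J T notnot (vars k) (vars-denote θ e))

        gadget⇒closed : (⟨ H , T ⟩⊨ᵗ τ gadget) → ∀ a → OverS a → Closed H T a
        gadget⇒closed f a@(p , rs) a∈ = record
          { marks     = proj₁ (to (chooseMark-⇔ θ e) (f (_ , rule (here refl) , θ))) tt
          ; marked    = proj₁ (to (useMark-⇔    θ e) (f (_ , rule (there (here refl)) , θ)))
          ; flagged   = proj₁ (to (raiseFlag-⇔  θ e) (f (_ , rule (there (there (here refl))) , θ)))
          ; saturated = proj₁ (to (saturate-⇔   θ e) (f (_ , rule (there (there (there (here refl)))) , θ)))
          }
          where
          θ = lookup rs
          e = tabulate-lookup rs
          rule : ∀ {R} → R ∈ gadgetRules (p , length rs) → R ∈ gadget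
          rule R∈ = ∈.∈-concatMap⁺ gadgetRules (lose a∈ R∈)

        closed⇒gadget : (∀ a → OverS a → Closed H T a) → (∀ a → OverS a → Closed T T a) → ⟨ H , T ⟩⊨ᵗ τ gadget
        closed⇒gadget cᴴ cᵀ (R , R∈ , θ) with find (∈.∈-concatMap⁻ gadgetRules {xs = S} R∈)
        ... | (p , k) , pk∈ , R∈′ = holds R∈′ θ
          where
          over : ∀ (θ : Fin k → _) → OverS (p , tabulate θ)
          over θ = subst (λ l → (p , l) ∈ S) (sym (length-tabulate θ)) pk∈
          holds : ∀ {R} → R ∈ gadgetRules (p , k) → ∀ θ → ⟨ H , T ⟩⊨ instanceFormula R θ
          holds (here refl) θ = from (chooseMark-⇔ θ refl)
            ((λ _ → Closed.marks (cᴴ _ (over θ))) , (λ _ → Closed.marks (cᵀ _ (over θ))))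
          holds (there (here refl)) θ = from (useMark-⇔ θ refl)
            (Closed.marked (cᴴ _ (over θ)) , Closed.marked (cᵀ _ (over θ)))
          holds (there (there (here refl))) θ = from (raiseFlag-⇔ θ refl)
            (Closed.flagged (cᴴ _ (over θ)) , Closed.flagged (cᵀ _ (over θ)))
          holds (there (there (there (here refl)))) θ = from (saturate-⇔ θ refl)
            (Closed.saturated (cᴴ _ (over θ)) , Closed.saturated (cᵀ _ (over θ)))

      -- Only base atoms over `S` are kept: others would be supported by no rule and would spoil
      -- minimality. As `h` is fresh, base atoms, marks and the flag never coincide.
      data Enc (A M : Pred 𝒫 0ℓ) (U : Set) : Pred 𝒫 0ℓ where
        base     : ∀ {a} → OverS a → A a → Enc A M U a
        marking  : ∀ {a} → OverS a → M a → Enc A M U (mark a)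
        flagging : U → Enc A M U flag

      h-not-over : ∀ {k} → (h , k) ∉ S
      h-not-over = fresh-h ∘ ∈.∈-map⁺ proj₁

      module _ {A M : Pred 𝒫 0ℓ} {U : Set} where

        Enc-base : AgreeOn OverS (Enc A M U) A
        Enc-base a a∈ = mk⇔
          (λ { (base _ x)    → x
             ; (marking _ _) → contradiction a∈ h-not-over
             ; (flagging _)  → contradiction a∈ h-not-over })
          (base a∈)

        Enc-mark : AgreeOn OverS (Enc A M U ∘ mark) M
        Enc-mark a a∈ = mk⇔
          (λ { (base h∈ _)   → contradiction h∈ h-not-over
             ; (marking _ x) → x })
          (marking a∈)

        Enc-flag : Enc A M U flag → U
        Enc-flag (base h∈ _)  = contradiction h∈ h-not-over
        Enc-flag (flagging x) = x

      module _ (em : ExcludedMiddle 0ℓ) {H T : Pred 𝒫 0ℓ} (H⊆T : H ⊆ T) where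

        Gap : Set
        Gap = ∃ λ a → OverS a × T a × ¬ H a

        X Y₀ : Pred 𝒫 0ℓ
        X  = Enc T H Gap
        Y₀ = Enc H H ⊥

        Y₀⊆X : Y₀ ⊆ X
        Y₀⊆X (base a∈ x)    = base a∈ (H⊆T x)
        Y₀⊆X (marking a∈ x) = marking a∈ x

        -- At a total pair the choice and saturation rules hold by excluded middle. An unmarked base
        -- atom lies in `T` but not in `H`, so it is itself the gap that the flag requires.
        X-closed : ∀ a → OverS a → Closed X X a
        X-closed a a∈ = record
          { marks     = toSum em
          ; marked    = base a∈ ∘ H⊆T ∘ to (Enc-mark a a∈)
          ; flagged   = λ (x , ¬m) → flagging (a , a∈ , to (Enc-base a a∈) x , ¬m ∘ marking a∈)
          ; saturated = decidable-stable em ∘ proj₂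
          }

        -- Every base atom of `Y₀` is in `H` and hence marked in `X`, so nothing raises the flag,
        -- and without the flag saturation is vacuous.
        Y₀-closed : ∀ a → OverS a → Closed Y₀ X a
        Y₀-closed a a∈ = record
          { marks     = Sum.map (from (Enc-mark a a∈)) (_∘ to (Enc-mark a a∈)) (toSum em)
          ; marked    = base a∈ ∘ to (Enc-mark a a∈)
          ; flagged   = λ (x , ¬m) → contradiction (marking a∈ (to (Enc-base a a∈) x)) ¬m
          ; saturated = ⊥-elim ∘ Enc-flag ∘ proj₁
          }

        module _ {Y : Pred 𝒫 0ℓ} (Y⊆X : Y ⊆ X) (Y-closed : ∀ a → OverS a → Closed Y X a) where

          -- A choice rule pins its atom: a mark true in `X` cannot be dropped in a smaller
          -- here-world.
          Y-mark : ∀ a → OverS a → H a → Y (mark a)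
          Y-mark a a∈ x = [ id , contradiction (marking a∈ x) ] (Closed.marks (Y-closed a a∈))

          -- The flag restores every base atom of `X` by saturation, and the marks are pinned
          -- anyway.
          flag⇒full : Y flag → X ⊆ Y
          flag⇒full f (base a∈ x)    = Closed.saturated (Y-closed _ a∈) (f , λ ¬x → ¬x (base a∈ x))
          flag⇒full f (marking a∈ x) = Y-mark _ a∈ x
          flag⇒full f (flagging _)   = f

          -- An atom of `Y` unmarked in `X` would raise the flag, so it is marked and lies in `H`;
          -- conversely, pinned marks force the atoms of `H` into `Y`.
          ¬flag⇒H : ¬ Y flag → AgreeOn OverS Y H
          ¬flag⇒H ¬f a a∈ =
            mk⇔ (λ y → decidable-stable em λ ¬x → ¬f (Closed.flagged (Y-closed a a∈) (y , ¬x ∘ to (Enc-mark a a∈))))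
                (Closed.marked (Y-closed a a∈) ∘ Y-mark a a∈)

        module _ {Π : Program Const} (Π⊆S : predicates Π ⊆ₗ S) where

          X⊨Π : (⟨ X , X ⟩⊨ᵗ τ Π) ⇔ (⟨ T , T ⟩⊨ᵗ τ Π)
          X⊨Π = localityᵗ Enc-base Enc-base Π Π⊆S

          -- A here-world with the flag is all of `X`. One without it agrees with `H` over `S` and
          -- would make `⟨ H , T ⟩` a model; the second hypothesis then excludes a gap, and without
          -- a gap `H` and `T` agree over `S`, so that again nothing of `X` is missing.
          X-answerSet : (⟨ T , T ⟩⊨ᵗ τ Π) → (Gap → ¬ (⟨ H , T ⟩⊨ᵗ τ Π)) → AnswerSet (Π ++ gadget) X
          X-answerSet f ¬g =
            from (τ-++ Π gadget) (from X⊨Π f , closed⇒gadget X-closed X-closed) , minimal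
            where
            minimal : ∀ Y → Y ⊂ X → ¬ (⟨ Y , X ⟩⊨ᵗ τ (Π ++ gadget))
            minimal Y (Y⊆X , X⊈Y) g = X⊈Y X⊆Y
              where
              g⊨ = to (τ-++ Π gadget) g
              closed = gadget⇒closed (proj₂ g⊨)
              X⊆Y : X ⊆ Y
              X⊆Y with em {Y flag}
              ... | yes f = flag⇒full Y⊆X closed f
              ... | no ¬f = λ
                { (base a∈ x)    → from (Y≈H _ a∈) (decidable-stable em λ ¬x → no-gap (_ , a∈ , x , ¬x))
                ; (marking a∈ x) → Y-mark Y⊆X closed _ a∈ x
                ; (flagging gap)  → contradiction gap no-gap
                }
                where
                Y≈H = ¬flag⇒H Y⊆X closed ¬f
                no-gap : ¬ Gap
                no-gap gap = ¬g gap (to (localityᵗ Y≈H Enc-base Π Π⊆S) (proj₁ g⊨))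

          -- The world `Y₀` refutes minimality: it encodes the model `⟨ H , T ⟩` and is properly
          -- smaller because the gap puts the flag into `X`.
          X-notAnswerSet : Gap → (⟨ H , T ⟩⊨ᵗ τ Π) → ¬ AnswerSet (Π ++ gadget) X
          X-notAnswerSet gap f (_ , minimal) =
            minimal Y₀ (Y₀⊆X , λ X⊆Y₀ → Enc-flag (X⊆Y₀ (flagging gap)))
              (from (τ-++ Π gadget) ( from (localityᵗ Enc-base Enc-base Π Π⊆S) f
                                    , closed⇒gadget Y₀-closed X-closed))

      -- Strong equivalence and here-and-there models

      module _ (em : ExcludedMiddle 0ℓ) {Π₁ Π₂ : Program Const}
               (Π₁⊆S : predicates Π₁ ⊆ₗ S) (Π₂⊆S : predicates Π₂ ⊆ₗ S)
               (Π₁≈Π₂ : StronglyEquivalent Π₁ Π₂) where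

        -- The encoding of (T , T) has no flag, and then no proper here-world.
        transferᵀ : ∀ {T} → (⟨ T , T ⟩⊨ᵗ τ Π₁) → ⟨ T , T ⟩⊨ᵗ τ Π₂
        transferᵀ {T} f =
          to (X⊨Π em {T} id {Π₂} Π₂⊆S) (proj₁ (to (τ-++ Π₂ gadget) (proj₁ answerSet₂)))
          where
          answerSet₁ : AnswerSet (Π₁ ++ gadget) (X em {T} id)
          answerSet₁ = X-answerSet em {T} id {Π₁} Π₁⊆S f (λ (_ , _ , x , ¬x) → contradiction x ¬x)
          answerSet₂ : AnswerSet (Π₂ ++ gadget) (X em {T} id)
          answerSet₂ = to (Π₁≈Π₂ gadget _) answerSet₁

        -- If `⟨ H , T ⟩` satisfied `Π₁` but not `Π₂`, then `X` would be an answer set of `Π₂` with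
        -- the context program but not of `Π₁` with it.
        transfer : ∀ {H T} → H ⊆ T → (⟨ H , T ⟩⊨ᵗ τ Π₁) → ⟨ H , T ⟩⊨ᵗ τ Π₂
        transfer {H} {T} H⊆T f = decidable-stable em λ ¬g →
          X-notAnswerSet em H⊆T {Π₁} Π₁⊆S (gap ¬g) f
            (from (Π₁≈Π₂ gadget _) (X-answerSet em H⊆T {Π₂} Π₂⊆S total (λ _ → ¬g)))
          where
          total : ⟨ T , T ⟩⊨ᵗ τ Π₂
          total = transferᵀ (persistenceᵗ H⊆T Π₁ f)
          -- Without a gap `H` and `T` agree over `S`, and `total` would already make `⟨ H , T ⟩` a
          -- model of `Π₂`.
          gap : ¬ (⟨ H , T ⟩⊨ᵗ τ Π₂) → Gap em H⊆T
          gap ¬g = decidable-stable em λ no-gap →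
            ¬g (to (localityᵗ (λ a a∈ → mk⇔ (λ x → decidable-stable em λ ¬x → no-gap (a , a∈ , x , ¬x)) H⊆T)
                      (λ _ _ → ⇔.refl) Π₂ Π₂⊆S) total)

  stronglyEquivalent⇒HT : ExcludedMiddle 0ℓ → ∀ {Π₁ Π₂} → StronglyEquivalent Π₁ Π₂ →
                          ∀ {H T} → H ⊆ T → (⟨ H , T ⟩⊨ᵗ τ Π₁) → ⟨ H , T ⟩⊨ᵗ τ Π₂
  stronglyEquivalent⇒HT em {Π₁} {Π₂} =
    -- One list covers both programs, since both must be joined with the same context program.
    let S = predicates Π₁ ++ predicates Π₂
        h , h∉ = infinite (map proj₁ S)
    in Gadget.transfer S h h∉ em {Π₁} {Π₂} ∈.∈-++⁺ˡ (∈.∈-++⁺ʳ (predicates Π₁))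

  AnswerSet-cong : ∀ {Π₁ Π₂} → (∀ {H T} → H ⊆ T → (⟨ H , T ⟩⊨ᵗ τ Π₁) ⇔ (⟨ H , T ⟩⊨ᵗ τ Π₂)) →
                   ∀ Π X → AnswerSet (Π₁ ++ Π) X → AnswerSet (Π₂ ++ Π) X
  AnswerSet-cong {Π₁} {Π₂} Π₁⇔Π₂ Π X (f , minimal) =
    to (swap id) f , λ Y Y⊂X g → minimal Y Y⊂X (from (swap (proj₁ Y⊂X)) g)
    where
    swap : ∀ {H T} → H ⊆ T → (⟨ H , T ⟩⊨ᵗ τ (Π₁ ++ Π)) ⇔ (⟨ H , T ⟩⊨ᵗ τ (Π₂ ++ Π))
    swap H⊆T = ⇔.trans (τ-++ Π₁ Π) (⇔.trans (Π₁⇔Π₂ H⊆T ×-⇔ ⇔.refl) (⇔.sym (τ-++ Π₂ Π)))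

theorem3 : ExcludedMiddle 0ℓ → (𝓢 : Signature) → let open Semantics 𝓢 in
    (Π₁ Π₂ : Program Const) →
    StronglyEquivalent Π₁ Π₂ ⇔
    (∀ (I : Interpretation) → I ⊨𝒜 → I ⊨ˢ map σ* (τ* Π₁) ⇔ I ⊨ˢ map σ* (τ* Π₂))
theorem3 em 𝓢 Π₁ Π₂ = mk⇔
  (λ Π₁≈Π₂ I I⊨𝒜 → let H⊆T = to (⊨𝒜⇔⊆ I) I⊨𝒜 in
    mk⇔ (from (τ*-⇔ H⊆T Π₂) ∘ stronglyEquivalent⇒HT em Π₁≈Π₂ H⊆T ∘ to (τ*-⇔ H⊆T Π₁))
        (from (τ*-⇔ H⊆T Π₁) ∘ stronglyEquivalent⇒HT em (λ Π X → ⇔.sym (Π₁≈Π₂ Π X)) H⊆T ∘ to (τ*-⇔ H⊆T Π₂)))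
  (λ equivalent Π X → mk⇔ (AnswerSet-cong (HT-⇔ equivalent) Π X)
                          (AnswerSet-cong (λ H⊆T → ⇔.sym (HT-⇔ equivalent H⊆T)) Π X))
  where
  open Semantics 𝓢
  open Correspondence 𝓢
  open Reduction 𝓢
  HT-⇔ : (∀ (I : Interpretation) → I ⊨𝒜 → I ⊨ˢ map σ* (τ* Π₁) ⇔ I ⊨ˢ map σ* (τ* Π₂)) →
         ∀ {H T} → H ⊆ T → (⟨ H , T ⟩⊨ᵗ τ Π₁) ⇔ (⟨ H , T ⟩⊨ᵗ τ Π₂)
  HT-⇔ equivalent {H} {T} H⊆T =
    ⇔.trans (⇔.sym (τ*-⇔ I⊆ Π₁)) (⇔.trans (equivalent I (from (⊨𝒜⇔⊆ I) I⊆)) (τ*-⇔ I⊆ Π₂))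
    where
    -- The worlds of this interpretation compute to `H` and `T`, so `H⊆T` serves as the inclusion
    -- for `I`.
    I = interpretation H T
    I⊆ : worldᴴ I ⊆ worldᵀ I
    I⊆ = H⊆T
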